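{- Let $k\geq 2$ and $n\geq k^{3}+2k^{2}+2k$ be integers. Then \[ \hat{r}(K_{1,k},K_{n})=\hat{r}^{*}(K_{1,k},K_{n})=\begin{cases}\binom{k(n-1)+1}{2}-\binom{k}{2} & \text{if } k \text{ is odd},\\[4pt] \binom{k(n-1)+1}{2}-k(n-1)/2 & \text{if } k \text{ is even}.\end{cases} \]
   Context: All graphs are finite and simple. $K_{1,k}$ is the star with $k$ edges and $K_n$ is the complete graph on $n$ vertices. For graphs $F,G,H$, write $F\longrightarrow(G,H)$ if every colouring of the edges of $F$ with red and blue yields a red copy of $G$ or a blue copy of $H$. The Ramsey number $r(G,H)$ is the least integer $N$ with $K_N\longrightarrow(G,H)$. The size Ramsey number $\hat{r}(G,H)$ is the minimum number of edges of a graph $F$ with $F\longrightarrow(G,H)$. The restricted size Ramsey number is $\hat{r}^{*}(G,H)=\min\{|E(F)| : F\longrightarrow(G,H),\ |V(F)|=r(G,H)\}$. -}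

module Defs where

open import Data.Nat using (ℕ; zero; suc; _+_; _*_; _∸_; _≤_; _<ᵇ_)
open import Data.Nat.DivMod using (_/_; _%_)
open import Data.Nat.Combinatorics using (_C_)
open import Data.Bool using (Bool; true; false; not; _∧_; _xor_; if_then_else_)
open import Data.Fin using (Fin; zero; suc; toℕ; _≟_)
open import Data.List using (List; map; allFin)
open import Data.Nat.ListAction using (sum)
open import Data.Product using (Σ; _×_; _,_; ∃)
open import Data.Sum using (_⊎_)
open import Function.Definitions using (Injective)
open import Relation.Nullary using (yes; no)
open import Relation.Nullary.Decidable using (⌊_⌋)
open import Relation.Binary.PropositionalEquality using (_≡_; refl; sym)

record Graph : Set where
  field
    V          : ℕ
    adj        : Fin V → Fin V → Bool
    adj-sym    : ∀ i j → adj i j ≡ adj j i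
    adj-irrefl : ∀ i → adj i i ≡ false
open Graph public

countFin : (m : ℕ) → (Fin m → Bool) → ℕ
countFin m p = sum (map (λ i → if p i then 1 else 0) (allFin m))

edges : Graph → ℕ
edges F = sum (map (λ i → countFin (V F) (λ j → (toℕ i <ᵇ toℕ j) ∧ adj F i j))
                   (allFin (V F)))

-- A red/blue edge colouring of F: a symmetric colour assignment to pairs
-- (only its values on edges matter). true = red, false = blue.
Colouring : Graph → Set
Colouring F = Σ (Fin (V F) → Fin (V F) → Bool) λ c → ∀ i j → c i j ≡ c j i

MonoCopy : (F : Graph) → Colouring F → Bool → Graph → Set
MonoCopy F (c , _) b G =
  Σ (Fin (V G) → Fin (V F)) λ φ →
    Injective _≡_ _≡_ φ ×
    (∀ i j → adj G i j ≡ true → (adj F (φ i) (φ j) ≡ true) × (c (φ i) (φ j) ≡ b))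

Arrows : Graph → Graph → Graph → Set
Arrows F G H = (c : Colouring F) → MonoCopy F c true G ⊎ MonoCopy F c false H

complete : ℕ → Graph
complete n = record
  { V = n
  ; adj = λ i j → not ⌊ i ≟ j ⌋
  ; adj-sym = symK
  ; adj-irrefl = irrK
  }
  where
    symK : ∀ (i j : Fin n) → not ⌊ i ≟ j ⌋ ≡ not ⌊ j ≟ i ⌋
    symK i j with i ≟ j | j ≟ i
    ... | yes _ | yes _ = refl
    ... | no _  | no _  = refl
    ... | yes p | no q  = Data.Empty.⊥-elim (q (sym p))
      where import Data.Empty
    ... | no p  | yes q = Data.Empty.⊥-elim (p (sym q))
      where import Data.Empty
    irrK : ∀ (i : Fin n) → not ⌊ i ≟ i ⌋ ≡ false
    irrK i with i ≟ i
    ... | yes _ = refl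
    ... | no p  = Data.Empty.⊥-elim (p refl)
      where import Data.Empty

isCentre : ∀ {k} → Fin (suc k) → Bool
isCentre zero    = true
isCentre (suc _) = false

star : ℕ → Graph
star k = record
  { V = suc k
  ; adj = λ i j → isCentre i xor isCentre j
  ; adj-sym = symS
  ; adj-irrefl = irrS
  }
  where
    symS : ∀ (i j : Fin (suc k)) → (isCentre i xor isCentre j) ≡ (isCentre j xor isCentre i)
    symS zero zero = refl
    symS zero (suc j) = refl
    symS (suc i) zero = refl
    symS (suc i) (suc j) = refl
    irrS : ∀ (i : Fin (suc k)) → (isCentre i xor isCentre i) ≡ false
    irrS zero = refl
    irrS (suc i) = refl

IsLeast : (ℕ → Set) → ℕ → Set
IsLeast P m = P m × (∀ m′ → P m′ → m ≤ m′)

IsRamseyNumber : Graph → Graph → ℕ → Set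
IsRamseyNumber G H = IsLeast (λ N → Arrows (complete N) G H)

IsSizeRamseyNumber : Graph → Graph → ℕ → Set
IsSizeRamseyNumber G H =
  IsLeast (λ e → Σ Graph λ F → Arrows F G H × edges F ≡ e)

IsRestrictedSizeRamseyNumber : Graph → Graph → ℕ → Set
IsRestrictedSizeRamseyNumber G H m =
  Σ ℕ λ r → IsRamseyNumber G H r ×
    IsLeast (λ e → Σ Graph λ F → Arrows F G H × V F ≡ r × edges F ≡ e) m

starCompleteValue : ℕ → ℕ → ℕ
starCompleteValue k n with k % 2
... | 1 = ((k * (n ∸ 1) + 1) C 2) ∸ (k C 2)
... | _ = ((k * (n ∸ 1) + 1) C 2) ∸ ((k * (n ∸ 1)) / 2)

{-# OPTIONS --safe #-}
-- Let R = n − 1. If the vertices of F admit R classes inducing maximum degree < k, then colouring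
-- the edges inside classes red avoids both a red star and a blue clique; call F winning at level R.
-- So an arrowing F is losing, and the lower bound says that a losing set W has volume (degree sum)
-- at least E(R) − t, where E(r) = kr(kr + 1) and t is k(k − 1) for odd k, kR for even k.
-- Local search (Lovász) shows that a set losing at level r contains a vertex of degree ≥ kr; a crude
-- bound, weaker than E(r) by r k(k − 1), follows by deleting k such vertices per level.
-- Suppose W loses at level r with volume below E(r) − t. Deleting k + 1 vertices that induce maximum
-- degree < k leaves a set losing at level r − 1; if their degrees are large the deficit grows.
-- If no such deletion exists, every vertex is adjacent to all but k − 1 vertices of almost full
-- degree, which lets one collect kr + 1 of the latter one at a time. In the complement graph on these
-- no k + 1 vertices span a subgraph without isolated vertices, which forces at most t missing
-- ordered pairs, a contradiction. So the deficit grows at each of k² successive levels, and the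
-- crude bound is violated.
-- For the upper bound take K_N, N = kR + 1, minus K_k (k odd) or minus a maximum matching (k even):
-- without a red star, the complement of the blue graph has an independent set of size ≥ N / k.
module Submission where

open import Defs
open import Data.Nat using (ℕ; zero; suc; _+_; _*_; _^_; _≤_; _<_; _<ᵇ_; _∸_; z≤n; s≤s; s≤s⁻¹)
open import Data.Nat.Properties renaming (_≟_ to _≟ℕ_)
open import Algebra.Properties.Semiring.Sum +-*-semiring
  using (sum; sum-cong-≗; ∑-distrib-+; ∑-comm; *-distribˡ-sum; *-distribʳ-sum)
import Data.Bool as Bool
open import Data.Bool using (Bool; true; false; not; _∧_; _∨_; if_then_else_)
open import Data.Bool.Properties using (∧-conicalˡ; ∧-conicalʳ; ∨-zeroʳ; ∧-zeroʳ; ∧-identityʳ; ⇔→≡)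
open import Data.Empty using (⊥; ⊥-elim)
open import Data.Fin using (Fin; zero; suc; _≟_; toℕ; fromℕ<; fromℕ)
open import Data.Fin.Properties
  using (any?; toℕ-injective; fromℕ<-injective; toℕ-fromℕ<; toℕ-fromℕ; toℕ≤pred[n]; injective⇒≤)
  renaming (suc-injective to suc-injectiveꟳ; 0≢1+n to 0≢1+nꟳ)
import Data.List as List
open import Data.List using ([]; _∷_)
open import Data.List.Properties using (map-tabulate)
open import Data.Nat.Combinatorics using (_C_; nCk+nC[k+1]≡[n+1]C[k+1]; nC1≡n)
open import Data.Nat.DivMod using (_/_; _%_; m≡m%n+[m/n]*n; m%n<n; m*n/n≡m)
import Data.Nat.ListAction as ListAction
open import Data.Nat.Tactic.RingSolver using (solve; solve-∀)
open import Data.Product using (Σ; _×_; _,_; ∃; proj₁; proj₂)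
open import Data.Sum using (_⊎_; inj₁; inj₂; [_,_]′)
open import Function using (_∘_; mk⇔)
open import Function.Definitions using (Injective)
open import Relation.Binary.PropositionalEquality
open import Relation.Nullary using (¬_; Dec; yes; no; does)
open import Relation.Nullary.Decidable using (dec-true; dec-false; _×-dec_)
open import Relation.Unary using (Decidable)

-- Vertex sets as indicator functions, their cardinalities and sums

⟦_⟧ : Bool → ℕ
⟦ true ⟧  = 1
⟦ false ⟧ = 0

VSet : ℕ → Set
VSet m = Fin m → Bool

infix 4 _∈_ _∉_ _⊆_ _≐_⊎_
infixl 6 _∖_ _∪_
infixl 7 _∩_

-- A record instead of the bare equation, so that unification recovers `v` and `A` from the type of
-- a membership proof. The opaque block below likewise keeps set expressions and sums from
-- unfolding.
record _∈_ {m : ℕ} (v : Fin m) (A : VSet m) : Set where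
  constructor mem
  field holds : A v ≡ true
open _∈_ public

_∉_ : ∀ {m} → Fin m → VSet m → Set
v ∉ A = ¬ v ∈ A

_⊆_ : ∀ {m} → VSet m → VSet m → Set
A ⊆ B = ∀ {v} → v ∈ A → v ∈ B

-- Disjointness is part of the equation: a common vertex of `A` and `B` would give 2 on the right.
-- Hence cardinalities, sums and degrees all split additively.
record _≐_⊎_ {m : ℕ} (W A B : VSet m) : Set where
  constructor split
  field pointwise : ∀ v → ⟦ W v ⟧ ≡ ⟦ A v ⟧ + ⟦ B v ⟧

_∈?_ : ∀ {m} (v : Fin m) (A : VSet m) → Dec (v ∈ A)
v ∈? A with A v in eq
... | true  = yes (mem eq)
... | false = no λ (mem p) → case-⊥ (trans (sym eq) p)
  where
  case-⊥ : false ≡ true → ⊥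
  case-⊥ ()

value-∉ : ∀ {m} {A : VSet m} {v} → v ∉ A → A v ≡ false
value-∉ {A = A} {v} h with A v in eq
... | true  = ⊥-elim (h (mem eq))
... | false = refl

sum-zero : ∀ {m} {f : Fin m → ℕ} → (∀ v → f v ≡ 0) → sum f ≡ 0
sum-zero {zero}  h = refl
sum-zero {suc m} h = cong₂ _+_ (h zero) (sum-zero (h ∘ suc))

sum-mono : ∀ {m} {f g : Fin m → ℕ} → (∀ v → f v ≤ g v) → sum f ≤ sum g
sum-mono {zero}  h = z≤n
sum-mono {suc m} h = +-mono-≤ (h zero) (sum-mono (h ∘ suc))

opaque
  _∩_ _∪_ _∖_ : ∀ {m} → VSet m → VSet m → VSet m
  (A ∩ B) v = A v ∧ B v
  (A ∪ B) v = A v ∨ B v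
  (A ∖ B) v = A v ∧ not (B v)

  ｛_｝ : ∀ {m} → Fin m → VSet m
  ｛ v ｝ u = does (u ≟ v)

  ⟪_⟫ : ∀ {m} {P : Fin m → Set} → Decidable P → VSet m
  ⟪ P? ⟫ v = does (P? v)

  everything : ∀ {m} → VSet m
  everything _ = true

  ∑⟨_⟩ : ∀ {m} → VSet m → (Fin m → ℕ) → ℕ
  ∑⟨ A ⟩ f = sum λ v → ⟦ A v ⟧ * f v

  card : ∀ {m} → VSet m → ℕ
  card A = sum λ v → ⟦ A v ⟧

  ⟪⟫-∈ : ∀ {m} {P : Fin m → Set} {P? : Decidable P} {v} → v ∈ ⟪ P? ⟫ → P v
  ⟪⟫-∈ {P? = P?} {v} (mem h) with P? v
  ... | yes p = p
  ⟪⟫-∈ (mem ()) | no _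

  ∈-⟪⟫ : ∀ {m} {P : Fin m → Set} {P? : Decidable P} {v} → P v → v ∈ ⟪ P? ⟫
  ∈-⟪⟫ {P? = P?} {v} p = mem (dec-true (P? v) p)

  everything-∈ : ∀ {m} {v : Fin m} → v ∈ everything
  everything-∈ = mem refl

  ∩-∈ : ∀ {m} {A B : VSet m} {v} → v ∈ A → v ∈ B → v ∈ A ∩ B
  ∩-∈ (mem p) (mem q) = mem (cong₂ _∧_ p q)

  ∩-∈ˡ : ∀ {m} {A B : VSet m} {v} → v ∈ A ∩ B → v ∈ A
  ∩-∈ˡ (mem p) = mem (∧-conicalˡ _ _ p)

  ∩-∈ʳ : ∀ {m} {A B : VSet m} {v} → v ∈ A ∩ B → v ∈ B
  ∩-∈ʳ {A = A} {v = v} (mem p) = mem (∧-conicalʳ (A v) _ p)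

  ∖-∈ : ∀ {m} {A B : VSet m} {v} → v ∈ A → v ∉ B → v ∈ A ∖ B
  ∖-∈ {B = B} (mem p) q = mem (cong₂ _∧_ p (cong not (value-∉ {A = B} q)))

  ∖-∈ˡ : ∀ {m} {A B : VSet m} {v} → v ∈ A ∖ B → v ∈ A
  ∖-∈ˡ (mem p) = mem (∧-conicalˡ _ _ p)

  ∖-∉ : ∀ {m} {A B : VSet m} {v} → v ∈ A ∖ B → v ∉ B
  ∖-∉ {A = A} {B} {v} (mem p) (mem q) with A v | B v
  ∖-∉ (mem ()) (mem refl) | true | .true
  ∖-∉ (mem ()) (mem refl) | false | .true

  ∪-∈ : ∀ {m} {A B : VSet m} {v} → v ∈ A ∪ B → v ∈ A ⊎ v ∈ B
  ∪-∈ {A = A} {v = v} (mem p) with A v in eq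
  ... | true  = inj₁ (mem eq)
  ... | false = inj₂ (mem p)

  ∪-∈ˡ : ∀ {m} {A B : VSet m} → A ⊆ A ∪ B
  ∪-∈ˡ {B = B} {v} (mem p) = mem (cong (_∨ B v) p)

  ∪-∈ʳ : ∀ {m} {A B : VSet m} → B ⊆ A ∪ B
  ∪-∈ʳ {A = A} {v = v} (mem p) = mem (trans (cong (A v ∨_) p) (∨-zeroʳ (A v)))

  ｛｝-∈ : ∀ {m} {u v : Fin m} → u ∈ ｛ v ｝ → u ≡ v
  ｛｝-∈ {u = u} {v} (mem p) with u ≟ v
  ... | yes e = e
  ｛｝-∈ (mem ()) | no _

  self-∈ : ∀ {m} {v : Fin m} → v ∈ ｛ v ｝
  self-∈ {v = v} = mem (dec-true (v ≟ v) refl)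

  ∩-∖-split : ∀ {m} (W P : VSet m) → W ≐ W ∩ P ⊎ W ∖ P
  ∩-∖-split W P = split λ v → lem (W v) (P v)
    where
    lem : ∀ w p → ⟦ w ⟧ ≡ ⟦ w ∧ p ⟧ + ⟦ w ∧ not p ⟧
    lem true  true  = refl
    lem true  false = refl
    lem false p     = refl

  ∖-split : ∀ {m} {W A : VSet m} → A ⊆ W → W ≐ A ⊎ W ∖ A
  ∖-split {W = W} {A} A⊆W = split λ v → lem v (A v) refl
    where
    lem : ∀ v a → A v ≡ a → ⟦ W v ⟧ ≡ ⟦ a ⟧ + ⟦ W v ∧ not a ⟧
    lem v true  p rewrite holds (A⊆W (mem p)) = refl
    lem v false p with W v
    ... | true  = refl
    ... | false = refl

  ∪-split : ∀ {m} {A B : VSet m} → (∀ {v} → v ∈ A → v ∉ B) → A ∪ B ≐ A ⊎ B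
  ∪-split {A = A} {B} dis = split λ v → lem v (A v) refl
    where
    lem : ∀ v a → A v ≡ a → ⟦ a ∨ B v ⟧ ≡ ⟦ a ⟧ + ⟦ B v ⟧
    lem v true  p rewrite value-∉ {A = B} (dis (mem p)) = refl
    lem v false p = refl

  split-∩ : ∀ {m} {W A B : VSet m} (P : VSet m) → W ≐ A ⊎ B → W ∩ P ≐ A ∩ P ⊎ B ∩ P
  split-∩ {W = W} {A} {B} P (split p) = split λ v → lem (W v) (A v) (B v) (P v) (p v)
    where
    lem : ∀ w a b q → ⟦ w ⟧ ≡ ⟦ a ⟧ + ⟦ b ⟧ → ⟦ w ∧ q ⟧ ≡ ⟦ a ∧ q ⟧ + ⟦ b ∧ q ⟧
    lem true  true  false q p = sym (+-identityʳ ⟦ q ⟧)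
    lem true  false true  q p = refl
    lem false false false q p = refl

  card-split : ∀ {m} {W A B : VSet m} → W ≐ A ⊎ B → card W ≡ card A + card B
  card-split {A = A} {B} (split p) = trans (sum-cong-≗ p) (∑-distrib-+ (⟦_⟧ ∘ A) (⟦_⟧ ∘ B))

  ∑-split : ∀ {m} {W A B : VSet m} (f : Fin m → ℕ) → W ≐ A ⊎ B → ∑⟨ W ⟩ f ≡ ∑⟨ A ⟩ f + ∑⟨ B ⟩ f
  ∑-split {A = A} {B} f (split p) =
    trans (sum-cong-≗ λ v → trans (cong (_* f v) (p v)) (*-distribʳ-+ (f v) ⟦ A v ⟧ ⟦ B v ⟧))
          (∑-distrib-+ (λ v → ⟦ A v ⟧ * f v) (λ v → ⟦ B v ⟧ * f v))

  ∑-mono : ∀ {m} {A : VSet m} {f g : Fin m → ℕ} → (∀ {v} → v ∈ A → f v ≤ g v) → ∑⟨ A ⟩ f ≤ ∑⟨ A ⟩ g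
  ∑-mono {A = A} {f} {g} h = sum-mono λ v → lem v (A v) refl
    where
    lem : ∀ v a → A v ≡ a → ⟦ a ⟧ * f v ≤ ⟦ a ⟧ * g v
    lem v true  p = +-monoˡ-≤ 0 (h (mem p))
    lem v false p = z≤n

  ∑-const : ∀ {m} (A : VSet m) c → ∑⟨ A ⟩ (λ _ → c) ≡ card A * c
  ∑-const A c = sym (*-distribʳ-sum c (⟦_⟧ ∘ A))

  ∑-add : ∀ {m} (A : VSet m) (f g : Fin m → ℕ) → ∑⟨ A ⟩ (λ v → f v + g v) ≡ ∑⟨ A ⟩ f + ∑⟨ A ⟩ g
  ∑-add A f g = trans (sum-cong-≗ λ v → *-distribˡ-+ ⟦ A v ⟧ (f v) (g v))
    (∑-distrib-+ (λ v → ⟦ A v ⟧ * f v) (λ v → ⟦ A v ⟧ * g v))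

  ∑-｛｝ : ∀ {m} (v : Fin m) (f : Fin m → ℕ) → ∑⟨ ｛ v ｝ ⟩ f ≡ f v
  ∑-｛｝ {suc m} zero f =
    trans (cong (f zero + 0 +_) (sum-zero {m} λ _ → refl)) (trans (+-identityʳ _) (+-identityʳ (f zero)))
  ∑-｛｝ (suc v) f = ∑-｛｝ v (f ∘ suc)

  card-everything : ∀ m → card {m} everything ≡ m
  card-everything zero    = refl
  card-everything (suc m) = cong suc (card-everything m)

  card-empty : ∀ {m} {A : VSet m} → (∀ v → v ∉ A) → card A ≡ 0
  card-empty {A = A} h = sum-zero λ v → cong ⟦_⟧ (value-∉ {A = A} (h v))

∑-cong : ∀ {m} {A : VSet m} {f g : Fin m → ℕ} → (∀ {v} → v ∈ A → f v ≡ g v) → ∑⟨ A ⟩ f ≡ ∑⟨ A ⟩ g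
∑-cong h = ≤-antisym (∑-mono λ p → ≤-reflexive (h p)) (∑-mono λ p → ≤-reflexive (sym (h p)))

card-∑ : ∀ {m} (A : VSet m) → ∑⟨ A ⟩ (λ _ → 1) ≡ card A
card-∑ A = trans (∑-const A 1) (*-identityʳ _)

card-｛｝ : ∀ {m} (v : Fin m) → card ｛ v ｝ ≡ 1
card-｛｝ v = trans (sym (card-∑ ｛ v ｝)) (∑-｛｝ v _)

card-⊆ : ∀ {m} {A B : VSet m} → A ⊆ B → card A ≤ card B
card-⊆ A⊆B = ≤-trans (m≤m+n _ _) (≤-reflexive (sym (card-split (∖-split A⊆B))))

card-≡ : ∀ {m} {A B : VSet m} → A ⊆ B → B ⊆ A → card A ≡ card B
card-≡ p q = ≤-antisym (card-⊆ p) (card-⊆ q)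

｛｝-⊆ : ∀ {m} {A : VSet m} {v} → v ∈ A → ｛ v ｝ ⊆ A
｛｝-⊆ {A = A} v∈A p = subst (_∈ A) (sym (｛｝-∈ p)) v∈A

insert-split : ∀ {m} {A : VSet m} {v} → v ∉ A → A ∪ ｛ v ｝ ≐ A ⊎ ｛ v ｝
insert-split {A = A} v∉A = ∪-split λ u∈A p → v∉A (subst (_∈ A) (｛｝-∈ p) u∈A)

remove-split : ∀ {m} {A : VSet m} {v} → v ∈ A → A ≐ ｛ v ｝ ⊎ A ∖ ｛ v ｝
remove-split v∈A = ∖-split (｛｝-⊆ v∈A)

card-insert : ∀ {m} {A : VSet m} {v} → v ∉ A → card (A ∪ ｛ v ｝) ≡ suc (card A)
card-insert {A = A} {v} h =
  trans (card-split (insert-split h)) (trans (cong (card A +_) (card-｛｝ v)) (+-comm (card A) 1))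

card-remove : ∀ {m} {A : VSet m} {v} → v ∈ A → card A ≡ suc (card (A ∖ ｛ v ｝))
card-remove {A = A} {v} v∈A =
  trans (card-split (remove-split v∈A)) (cong (_+ card (A ∖ ｛ v ｝)) (card-｛｝ v))

find : ∀ {m} {P : Fin m → Set} → Decidable P → ∃ P ⊎ (∀ v → ¬ P v)
find P? with any? P?
... | yes p = inj₁ p
... | no h  = inj₂ λ v p → h (v , p)

card>0⇒∃ : ∀ {m} {A : VSet m} → 0 < card A → ∃ λ v → v ∈ A
card>0⇒∃ {A = A} pos with find (_∈? A)
... | inj₁ p = p
... | inj₂ h = ⊥-elim (<-irrefl (sym (card-empty h)) pos)

card<⇒∃ : ∀ {m} {A B : VSet m} → card A < card B → ∃ λ v → v ∈ B × v ∉ A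
card<⇒∃ {A = A} {B} lt with card>0⇒∃ (+-cancelˡ-< (card A) 0 _ (begin-strict
    card A + 0                  ≡⟨ +-identityʳ _ ⟩
    card A                      <⟨ lt ⟩
    card B                      ≡⟨ card-split (∩-∖-split B A) ⟩
    card (B ∩ A) + card (B ∖ A) ≤⟨ +-monoˡ-≤ _ (card-⊆ ∩-∈ʳ) ⟩
    card A + card (B ∖ A)       ∎))
  where open ≤-Reasoning
... | v , p = v , ∖-∈ˡ p , ∖-∉ p

insert-⊆ : ∀ {m} {A B : VSet m} {v} → A ⊆ B → v ∈ B → A ∪ ｛ v ｝ ⊆ B
insert-⊆ A⊆B v∈B p with ∪-∈ p
... | inj₁ q = A⊆B q
... | inj₂ q = ｛｝-⊆ v∈B q

subsetOfSize : ∀ {m} (A : VSet m) t → t ≤ card A → ∃ λ B → B ⊆ A × card B ≡ t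
subsetOfSize A zero    le = A ∖ A , ∖-∈ˡ , card-empty λ v p → ∖-∉ p (∖-∈ˡ p)
subsetOfSize A (suc t) le with subsetOfSize A t (<⇒≤ le)
... | B , B⊆A , refl with card<⇒∃ le
... | v , v∈A , v∉B = B ∪ ｛ v ｝ , insert-⊆ B⊆A v∈A , card-insert v∉B

-- Graphs on a fixed vertex set, degrees and volumes

record GraphOn (m : ℕ) : Set where
  field
    nbr        : Fin m → VSet m
    nbr-sym    : ∀ {u v} → u ∈ nbr v → v ∈ nbr u
    nbr-irrefl : ∀ {v} → v ∉ nbr v
open GraphOn

nbr-≡ : ∀ {m} (G : GraphOn m) u v → nbr G u v ≡ nbr G v u
nbr-≡ G u v = ⇔→≡ (mk⇔ (λ p → holds (nbr-sym G (mem p))) (λ p → holds (nbr-sym G (mem p))))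

deg : ∀ {m} → GraphOn m → VSet m → Fin m → ℕ
deg G A v = card (A ∩ nbr G v)

cross : ∀ {m} → GraphOn m → VSet m → VSet m → ℕ
cross G A B = ∑⟨ A ⟩ (deg G B)

-- Counting ordered pairs, that is, twice the edges induced by `A`, avoids halving until the very
-- end.
vol : ∀ {m} → GraphOn m → VSet m → ℕ
vol G A = cross G A A

colourClass : ∀ {m} → (Fin m → ℕ) → ℕ → VSet m
colourClass f c = ⟪ (λ u → f u ≟ℕ c) ⟫

mono : ∀ {m} → GraphOn m → (Fin m → ℕ) → GraphOn m
mono G f = record
  { nbr        = λ v → nbr G v ∩ colourClass f (f v)
  ; nbr-sym    = λ p → ∩-∈ (nbr-sym G (∩-∈ˡ p)) (∈-⟪⟫ (sym (⟪⟫-∈ (∩-∈ʳ p))))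
  ; nbr-irrefl = λ p → nbr-irrefl G (∩-∈ˡ p)
  }

-- Colours are plain naturals, bounded only on `W`, so that `W` can shrink and `r` can grow while
-- `f` keeps its type.
Wins : ∀ {m} → GraphOn m → ℕ → VSet m → ℕ → Set
Wins {m} G k W r = Σ (Fin m → ℕ) λ f → ∀ {v} → v ∈ W → f v < r × deg (mono G f) W v < k

module _ {m : ℕ} (G : GraphOn m) where

  deg-split : ∀ {W A B} v → W ≐ A ⊎ B → deg G W v ≡ deg G A v + deg G B v
  deg-split v s = card-split (split-∩ (nbr G v) s)

  deg-⊆ : ∀ {A B} v → A ⊆ B → deg G A v ≤ deg G B v
  deg-⊆ v A⊆B = card-⊆ λ p → ∩-∈ (A⊆B (∩-∈ˡ p)) (∩-∈ʳ p)

  deg<card : ∀ {A v} → v ∈ A → deg G A v < card A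
  deg<card {A} {v} v∈A = ≤-trans
    (s≤s (card-⊆ λ p → ∖-∈ (∩-∈ˡ p) λ q → nbr-irrefl G (subst (_∈ nbr G v) (｛｝-∈ q) (∩-∈ʳ p))))
    (≤-reflexive (sym (card-remove v∈A)))

  deg>0⇒∃ : ∀ {A v} → 0 < deg G A v → ∃ λ u → u ∈ A × u ∈ nbr G v
  deg>0⇒∃ pos with card>0⇒∃ pos
  ... | u , p = u , ∩-∈ˡ p , ∩-∈ʳ p

  ∈⇒deg>0 : ∀ {A v u} → u ∈ A → u ∈ nbr G v → 0 < deg G A v
  ∈⇒deg>0 p q = ≤-trans (s≤s z≤n) (≤-reflexive (sym (card-remove (∩-∈ p q))))

  opaque
    unfolding card
    -- Double counting of the adjacent pairs with one end in `A` and the other in `B`.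
    cross-comm : ∀ A B → cross G A B ≡ cross G B A
    cross-comm A B = begin
      sum (λ v → ⟦ A v ⟧ * sum (λ u → ⟦ B u ∧ nbr G v u ⟧))
        ≡⟨ sum-cong-≗ (λ v → *-distribˡ-sum ⟦ A v ⟧ λ u → ⟦ B u ∧ nbr G v u ⟧) ⟩
      sum (λ v → sum (λ u → ⟦ A v ⟧ * ⟦ B u ∧ nbr G v u ⟧))
        ≡⟨ ∑-comm (λ v u → ⟦ A v ⟧ * ⟦ B u ∧ nbr G v u ⟧) ⟩
      sum (λ u → sum (λ v → ⟦ A v ⟧ * ⟦ B u ∧ nbr G v u ⟧))
        ≡⟨ sum-cong-≗ (λ u → sum-cong-≗ λ v → swap (A v) (B u) (nbr G v u) (nbr G u v) (nbr-≡ G v u)) ⟩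
      sum (λ u → sum (λ v → ⟦ B u ⟧ * ⟦ A v ∧ nbr G u v ⟧))
        ≡⟨ sum-cong-≗ (λ u → *-distribˡ-sum ⟦ B u ⟧ λ v → ⟦ A v ∧ nbr G u v ⟧) ⟨
      sum (λ u → ⟦ B u ⟧ * sum (λ v → ⟦ A v ∧ nbr G u v ⟧)) ∎
      where
      open ≡-Reasoning
      swap : ∀ a b x y → x ≡ y → ⟦ a ⟧ * ⟦ b ∧ x ⟧ ≡ ⟦ b ⟧ * ⟦ a ∧ y ⟧
      swap true  true  x y refl = refl
      swap true  false x y refl = refl
      swap false true  x y refl = refl
      swap false false x y refl = refl

  vol-split : ∀ {W A B} → W ≐ A ⊎ B → vol G W ≡ vol G A + vol G B + 2 * cross G A B
  vol-split {W} {A} {B} s = begin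
    cross G W W
      ≡⟨ ∑-split (deg G W) s ⟩
    cross G A W + cross G B W
      ≡⟨ cong₂ _+_ (half A) (half B) ⟩
    (vol G A + cross G A B) + (cross G B A + vol G B)
      ≡⟨ cong (λ x → (vol G A + cross G A B) + (x + vol G B)) (cross-comm B A) ⟩
    (vol G A + cross G A B) + (cross G A B + vol G B)
      ≡⟨ rearrange (vol G A) (vol G B) (cross G A B) ⟩
    vol G A + vol G B + 2 * cross G A B ∎
    where
    open ≡-Reasoning
    half : ∀ U → cross G U W ≡ cross G U A + cross G U B
    half U = trans (∑-cong λ {v} _ → deg-split v s) (∑-add U (deg G A) (deg G B))
    rearrange : ∀ x y z → (x + z) + (z + y) ≡ x + y + 2 * z
    rearrange = solve-∀

  deg-self : ∀ v → deg G ｛ v ｝ v ≡ 0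
  deg-self v = card-empty λ u p → nbr-irrefl G (subst (_∈ nbr G v) (｛｝-∈ (∩-∈ˡ p)) (∩-∈ʳ p))

  vol-｛｝ : ∀ v → vol G ｛ v ｝ ≡ 0
  vol-｛｝ v = trans (∑-｛｝ v (deg G ｛ v ｝)) (deg-self v)

  deg-remove : ∀ {W v} → v ∈ W → deg G W v ≡ deg G (W ∖ ｛ v ｝) v
  deg-remove {W} {v} v∈W = trans (deg-split v (remove-split v∈W)) (cong (_+ deg G (W ∖ ｛ v ｝) v) (deg-self v))

  vol-remove : ∀ {W v} → v ∈ W → vol G W ≡ vol G (W ∖ ｛ v ｝) + 2 * deg G W v
  vol-remove {W} {v} v∈W = begin
    vol G W
      ≡⟨ vol-split (remove-split v∈W) ⟩
    vol G ｛ v ｝ + vol G (W ∖ ｛ v ｝) + 2 * cross G ｛ v ｝ (W ∖ ｛ v ｝)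
      ≡⟨ cong₂ (λ x y → x + vol G (W ∖ ｛ v ｝) + 2 * y) (vol-｛｝ v)
               (trans (∑-｛｝ v (deg G (W ∖ ｛ v ｝))) (sym (deg-remove v∈W))) ⟩
    vol G (W ∖ ｛ v ｝) + 2 * deg G W v ∎
    where open ≡-Reasoning

  vol-⊆ : ∀ {A B} → A ⊆ B → vol G A ≤ vol G B
  vol-⊆ A⊆B = ≤-trans (≤-trans (m≤m+n _ _) (m≤m+n _ _)) (≤-reflexive (sym (vol-split (∖-split A⊆B))))

vol-mono : ∀ {m} (G H : GraphOn m) {A} →
  (∀ {u v} → u ∈ A → v ∈ A → u ∈ nbr G v → u ∈ nbr H v) → vol G A ≤ vol H A
vol-mono G H G⊆H = ∑-mono λ v∈A → card-⊆ λ p → ∩-∈ (∩-∈ˡ p) (G⊆H (∩-∈ˡ p) v∈A (∩-∈ʳ p))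

-- Local search and ways to win

pigeonhole-classes : ∀ {m} (f : Fin m → ℕ) A κ r → card A < r * κ →
  ∃ λ c → c < r × card (A ∩ colourClass f c) < κ
pigeonhole-classes f A κ (suc r) lt with card (A ∩ colourClass f r) <? κ
... | yes p = r , ≤-refl , p
... | no p with pigeonhole-classes f (A ∖ colourClass f r) κ r
                  (+-cancelˡ-< κ _ _ (≤-<-trans (+-monoˡ-≤ _ (≮⇒≥ p))
                    (subst (_< κ + r * κ) (card-split (∩-∖-split A (colourClass f r))) lt)))
... | c , c<r , q = c , m<n⇒m<1+n c<r , ≤-<-trans (card-⊆ sub) q
  where
  sub : A ∩ colourClass f c ⊆ (A ∖ colourClass f r) ∩ colourClass f c
  sub p = ∩-∈ (∖-∈ (∩-∈ˡ p) λ q → <-irrefl (trans (sym (⟪⟫-∈ (∩-∈ʳ p))) (⟪⟫-∈ q)) c<r) (∩-∈ʳ p)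

recolour : ∀ {m} → (Fin m → ℕ) → Fin m → ℕ → Fin m → ℕ
recolour f v c u = if does (u ≟ v) then c else f u

recolour-self : ∀ {m} (f : Fin m → ℕ) v c → recolour f v c v ≡ c
recolour-self f v c rewrite dec-true (v ≟ v) refl = refl

recolour-other : ∀ {m} (f : Fin m → ℕ) {u v} c → ¬ u ≡ v → recolour f v c u ≡ f u
recolour-other f {u} {v} c u≢v rewrite dec-false (u ≟ v) u≢v = refl

module _ {m : ℕ} (G : GraphOn m) (k : ℕ) where

  private
    Φ : (Fin m → ℕ) → VSet m → ℕ
    Φ f = vol (mono G f)

    recoloured-deg : ∀ f {W v} c →
      deg (mono G (recolour f v c)) W v ≤ card ((W ∩ nbr G v) ∩ colourClass f c)
    recoloured-deg f {W} {v} c = card-⊆ λ {u} p →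
      let u∈W = ∩-∈ˡ p ; u~v = ∩-∈ˡ (∩-∈ʳ p)
          u≢v = λ u≡v → nbr-irrefl G (subst (_∈ nbr G v) u≡v u~v)
      in ∩-∈ (∩-∈ u∈W u~v) (∈-⟪⟫ (trans (sym (recolour-other f c u≢v))
           (trans (⟪⟫-∈ (∩-∈ʳ (∩-∈ʳ p))) (recolour-self f v c))))

    recoloured-vol : ∀ f {W v} c → Φ (recolour f v c) (W ∖ ｛ v ｝) ≤ Φ f (W ∖ ｛ v ｝)
    recoloured-vol f {W} {v} c = vol-mono (mono G (recolour f v c)) (mono G f) λ {u} {w} u∈ w∈ p →
      ∩-∈ (∩-∈ˡ p) (∈-⟪⟫ (trans (sym (recolour-other f c (other u∈)))
        (trans (⟪⟫-∈ (∩-∈ʳ p)) (recolour-other f c (other w∈)))))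
      where
      other : ∀ {u} → u ∈ W ∖ ｛ v ｝ → ¬ u ≡ v
      other p refl = ∖-∉ p self-∈

  -- Local search à la Lovász: recolouring a vertex into a class where it has fewer than k
  -- neighbours decreases the number of monochromatic edges.
  localSearch : ∀ W r N f → (∀ {v} → v ∈ W → f v < r) → Φ f W < N →
    Wins G k W r ⊎ ∃ λ v → v ∈ W × r * k ≤ deg G W v
  localSearch W r (suc N) f f<r bound with find (λ v → (v ∈? W) ×-dec (k ≤? deg (mono G f) W v))
  ... | inj₂ none = inj₁ (f , λ v∈W → f<r v∈W , ≰⇒> λ h → none _ (v∈W , h))
  ... | inj₁ (v , v∈W , bad) with r * k ≤? deg G W v
  ...   | yes big = inj₂ (v , v∈W , big)
  ...   | no small with pigeonhole-classes f (W ∩ nbr G v) k r (≰⇒> small)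
  -- `N` bounds the number of monochromatic ordered pairs, which drops with each recolouring; this
  -- makes the recursion structural.
  ...     | c , c<r , few = localSearch W r N (recolour f v c) f′<r (≤-trans decreases (s≤s⁻¹ bound))
    where
    f′<r : ∀ {u} → u ∈ W → recolour f v c u < r
    f′<r {u} u∈W with u ≟ v
    ... | yes refl = c<r
    ... | no u≢v   = f<r u∈W
    decreases : Φ (recolour f v c) W < Φ f W
    decreases = begin-strict
      Φ (recolour f v c) W
        ≡⟨ vol-remove (mono G (recolour f v c)) v∈W ⟩
      Φ (recolour f v c) (W ∖ ｛ v ｝) + 2 * deg (mono G (recolour f v c)) W v
        <⟨ +-mono-≤-< (recoloured-vol f c)
             (*-monoʳ-< 2 (<-≤-trans (≤-<-trans (recoloured-deg f c) few) bad)) ⟩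
      Φ f (W ∖ ｛ v ｝) + 2 * deg (mono G f) W v
        ≡⟨ vol-remove (mono G f) v∈W ⟨
      Φ f W ∎
      where open ≤-Reasoning

  lovász : ∀ {W r} → ¬ Wins G k W r → ∃ λ v → v ∈ W × r * k ≤ deg G W v
  -- With no class available only the empty set wins, so any vertex of a losing `W` will do.
  lovász {W} {zero} fails with find (_∈? W)
  ... | inj₁ (v , v∈W) = v , v∈W , z≤n
  ... | inj₂ empty     = ⊥-elim (fails ((λ _ → 0) , λ v∈W → ⊥-elim (empty _ v∈W)))
  lovász {W} {suc r} fails with localSearch W (suc r) _ (λ _ → 0) (λ _ → s≤s z≤n) ≤-refl
  ... | inj₁ wins  = ⊥-elim (fails wins)
  ... | inj₂ found = found

  wins-⊆ : ∀ {A B r} → A ⊆ B → Wins G k B r → Wins G k A r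
  wins-⊆ A⊆B (f , ok) = f , λ v∈A → proj₁ (ok (A⊆B v∈A)) ,
    ≤-<-trans (deg-⊆ (mono G f) _ A⊆B) (proj₂ (ok (A⊆B v∈A)))

  -- `D` receives the colour `r`, which `f` does not use on the rest of `W`, so no monochromatic
  -- edge leaves `D`.
  wins-block : ∀ {W D r} → (∀ {v} → v ∈ D → deg G D v < k) → Wins G k (W ∖ D) r → Wins G k W (suc r)
  wins-block {W} {D} {r} sparse (f , ok) = f′ , λ {v} v∈W → good v v∈W (v ∈? D)
    where
    f′ : Fin m → ℕ
    f′ u = if does (u ∈? D) then r else f u
    f′-in : ∀ {u} → u ∈ D → f′ u ≡ r
    f′-in {u} p rewrite dec-true (u ∈? D) p = refl
    f′-out : ∀ {u} → u ∉ D → f′ u ≡ f u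
    f′-out {u} p rewrite dec-false (u ∈? D) p = refl
    good : ∀ v → v ∈ W → Dec (v ∈ D) → f′ v < suc r × deg (mono G f′) W v < k
    good v v∈W (yes v∈D) = ≤-reflexive (cong suc (f′-in v∈D)) , ≤-<-trans (card-⊆ sub) (sparse v∈D)
      where
      sub : W ∩ (nbr G v ∩ colourClass f′ (f′ v)) ⊆ D ∩ nbr G v
      sub {u} p with u ∈? D
      ... | yes u∈D = ∩-∈ u∈D (∩-∈ˡ (∩-∈ʳ p))
      ... | no u∉D  = ⊥-elim (<-irrefl
        (trans (sym (f′-out u∉D)) (trans (⟪⟫-∈ (∩-∈ʳ (∩-∈ʳ p))) (f′-in v∈D)))
        (proj₁ (ok (∖-∈ (∩-∈ˡ p) u∉D))))
    good v v∈W (no v∉D) =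
      subst (_< suc r) (sym (f′-out v∉D)) (m<n⇒m<1+n (proj₁ (ok v∈W∖D))) ,
      ≤-<-trans (card-⊆ sub) (proj₂ (ok v∈W∖D))
      where
      v∈W∖D : v ∈ W ∖ D
      v∈W∖D = ∖-∈ v∈W v∉D
      sub : W ∩ (nbr G v ∩ colourClass f′ (f′ v)) ⊆ (W ∖ D) ∩ (nbr G v ∩ colourClass f (f v))
      sub {u} p with u ∈? D
      ... | yes u∈D = ⊥-elim (<-irrefl
        (trans (sym (f′-out v∉D)) (trans (sym (⟪⟫-∈ (∩-∈ʳ (∩-∈ʳ p)))) (f′-in u∈D)))
        (proj₁ (ok v∈W∖D)))
      ... | no u∉D = ∩-∈ (∖-∈ (∩-∈ˡ p) u∉D) (∩-∈ (∩-∈ˡ (∩-∈ʳ p))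
        (∈-⟪⟫ (trans (sym (f′-out u∉D)) (trans (⟪⟫-∈ (∩-∈ʳ (∩-∈ʳ p))) (f′-out v∉D)))))

  wins-small-block : ∀ {W D r} → card D ≤ k → Wins G k (W ∖ D) r → Wins G k W (suc r)
  wins-small-block le = wins-block λ v∈D → <-≤-trans (deg<card G v∈D) le

  -- Any `k` vertices may form a class, since degrees among them are at most k - 1; `A` is used up
  -- in such pieces.
  wins-blocks : ∀ {W} c A {r} → card A ≤ c * k → Wins G k (W ∖ A) r → Wins G k W (c + r)
  wins-blocks zero A le wins = wins-⊆ (λ v∈W → ∖-∈ v∈W λ v∈A →
    <-irrefl refl (≤-trans (≤-trans (s≤s z≤n) (≤-reflexive (sym (card-remove v∈A)))) le)) wins
  wins-blocks {W} (suc c) A {r} le wins with piece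
    where
    piece : ∃ λ B → B ⊆ A × card B ≤ k × card (A ∖ B) ≤ c * k
    piece with k ≤? card A
    ... | no small = A , (λ p → p) , <⇒≤ (≰⇒> small) ,
      ≤-trans (≤-reflexive (card-empty λ v p → ∖-∉ p (∖-∈ˡ p))) z≤n
    ... | yes big with subsetOfSize A k big
    ...   | B , B⊆A , refl = B , B⊆A , ≤-refl ,
      +-cancelˡ-≤ (card B) _ _ (≤-trans (≤-reflexive (sym (card-split (∖-split B⊆A)))) le)
  ... | B , B⊆A , B≤k , rest = subst (Wins G k W) (+-suc c r)
    (wins-blocks c (A ∖ B) rest (wins-small-block B≤k
      (wins-⊆ (λ p → ∖-∈ (∖-∈ˡ (∖-∈ˡ p)) λ q → ∖-∉ (∖-∈ˡ p) (∖-∈ q (∖-∉ p))) wins)))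

  -- Fewer than `r` neighbours leave some class without a neighbour of `v`. There `v` is isolated,
  -- so no monochromatic degree grows.
  wins-low-degree : ∀ {W v r} → 0 < k → v ∈ W → deg G W v < r → Wins G k (W ∖ ｛ v ｝) r → Wins G k W r
  wins-low-degree {W} {v} {r} k>0 v∈W low (f , ok)
    with pigeonhole-classes f (W ∩ nbr G v) 1 r (≤-trans low (≤-reflexive (sym (*-identityʳ r))))
  ... | c , c<r , none = recolour f v c , λ {u} u∈W → good u u∈W (u ≟ v)
    where
    good : ∀ u → u ∈ W → Dec (u ≡ v) → recolour f v c u < r × deg (mono G (recolour f v c)) W u < k
    good u u∈W (yes refl) = subst (_< r) (sym (recolour-self f v c)) c<r ,
      ≤-trans (≤-<-trans (recoloured-deg f c) none) k>0
    good u u∈W (no u≢v) =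
      subst (_< r) (sym (recolour-other f c u≢v)) (proj₁ (ok u∈W′)) ,
      ≤-<-trans (card-⊆ sub) (proj₂ (ok u∈W′))
      where
      u∈W′ : u ∈ W ∖ ｛ v ｝
      u∈W′ = ∖-∈ u∈W (u≢v ∘ ｛｝-∈)
      sub : W ∩ nbr (mono G (recolour f v c)) u ⊆ (W ∖ ｛ v ｝) ∩ nbr (mono G f) u
      sub {w} p with w ≟ v
      ... | yes refl = ⊥-elim (<-irrefl refl (≤-trans (≤-trans (s≤s z≤n) (≤-reflexive (sym (card-remove
        (∩-∈ (∩-∈ u∈W (nbr-sym G (∩-∈ˡ (∩-∈ʳ p)))) (∈-⟪⟫ (trans (sym (recolour-other f c u≢v))
          (trans (sym (⟪⟫-∈ (∩-∈ʳ (∩-∈ʳ p)))) (recolour-self f v c))))))))) (s≤s⁻¹ none)))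
      ... | no w≢v = ∩-∈ (∖-∈ (∩-∈ˡ p) (w≢v ∘ ｛｝-∈)) (∩-∈ (∩-∈ˡ (∩-∈ʳ p))
        (∈-⟪⟫ (trans (sym (recolour-other f c w≢v))
          (trans (⟪⟫-∈ (∩-∈ʳ (∩-∈ʳ p))) (recolour-other f c u≢v)))))

  -- Vertices of degree below `r` are deleted as long as there are any, which preserves losing. The
  -- minimum degree so obtained controls the one vertex of a deleted set that need not have high
  -- degree.
  peel : ∀ N W {r} → 0 < k → card W < N → ¬ Wins G k W r →
    ∃ λ W′ → W′ ⊆ W × ¬ Wins G k W′ r × (∀ {v} → v ∈ W′ → r ≤ deg G W′ v)
  peel (suc N) W {r} k>0 bound fails with find (λ v → (v ∈? W) ×-dec (deg G W v <? r))
  ... | inj₂ none = W , (λ p → p) , fails , λ v∈W → ≮⇒≥ λ lt → none _ (v∈W , lt)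
  ... | inj₁ (v , v∈W , low) with peel N (W ∖ ｛ v ｝) k>0
          (≤-trans (≤-reflexive (sym (card-remove v∈W))) (s≤s⁻¹ bound))
          (fails ∘ wins-low-degree k>0 v∈W low)
  ...   | W′ , sub , fails′ , high = W′ , ∖-∈ˡ ∘ sub , fails′ , high

-- A certificate for a linear inequality: a ≤ b sums up the hypotheses and s is the slack.
≤-certificate : ∀ {a b L R} s → a ≤ b → R + a ≡ L + b + s → L ≤ R
≤-certificate {a} {b} {L} {R} s a≤b eq = +-cancelʳ-≤ b L R
  (≤-trans (m≤m+n (L + b) s) (≤-trans (≤-reflexive (sym eq)) (+-monoʳ-≤ R a≤b)))

infixr 5 _⊕_
_⊕_ : ∀ {a b c d} → a ≤ b → c ≤ d → a + c ≤ b + d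
_⊕_ = +-mono-≤

-- Volumes of complete graphs and of complements

pairs : ℕ → ℕ
pairs a = a * suc a

-- The volume of the complete graph on `r * k + 1` vertices, as `pairs a` counts the ordered pairs
-- of distinct elements among a + 1.
E : ℕ → ℕ → ℕ
E k r = pairs (r * k)

complement : ∀ {m} → GraphOn m → GraphOn m
complement G = record
  { nbr        = λ v → (everything ∖ ｛ v ｝) ∖ nbr G v
  ; nbr-sym    = λ p → ∖-∈ (∖-∈ everything-∈ λ q → ∖-∉ (∖-∈ˡ p) (subst (_∈ ｛ _ ｝) (｛｝-∈ q) self-∈))
                           (∖-∉ p ∘ nbr-sym G)
  ; nbr-irrefl = λ p → ∖-∉ (∖-∈ˡ p) self-∈
  }

module _ {m : ℕ} (G : GraphOn m) where

  complement-∈ : ∀ {u v} → ¬ u ≡ v → u ∉ nbr G v → u ∈ nbr (complement G) v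
  complement-∈ u≢v u≁v = ∖-∈ (∖-∈ everything-∈ (u≢v ∘ ｛｝-∈)) u≁v

  deg-complement-∉ : ∀ {A v} → v ∉ A → deg G A v + deg (complement G) A v ≡ card A
  deg-complement-∉ {A} {v} v∉A = sym (trans (card-split (∩-∖-split A (nbr G v))) (cong (deg G A v +_)
    (card-≡ (λ p → ∩-∈ (∖-∈ˡ p) (complement-∈ (λ u≡v → v∉A (subst (_∈ A) u≡v (∖-∈ˡ p))) (∖-∉ p)))
            (λ p → ∖-∈ (∩-∈ˡ p) (∖-∉ (∩-∈ʳ p))))))

  deg-complement-∈ : ∀ {A v} → v ∈ A → suc (deg G A v + deg (complement G) A v) ≡ card A
  deg-complement-∈ {A} {v} v∈A = begin
    suc (deg G A v + deg (complement G) A v)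
      ≡⟨ cong suc (cong₂ _+_ (deg-remove G v∈A) (deg-remove (complement G) v∈A)) ⟩
    suc (deg G (A ∖ ｛ v ｝) v + deg (complement G) (A ∖ ｛ v ｝) v)
      ≡⟨ cong suc (deg-complement-∉ λ p → ∖-∉ p self-∈) ⟩
    suc (card (A ∖ ｛ v ｝))
      ≡⟨ card-remove v∈A ⟨
    card A ∎
    where open ≡-Reasoning

  vol-complement : ∀ A {a} → card A ≡ suc a → vol G A + vol (complement G) A ≡ pairs a
  vol-complement A {a} |A| = begin
    vol G A + vol (complement G) A
      ≡⟨ ∑-add A (deg G A) (deg (complement G) A) ⟨
    ∑⟨ A ⟩ (λ v → deg G A v + deg (complement G) A v)
      ≡⟨ ∑-cong (λ v∈A → suc-injective (trans (deg-complement-∈ v∈A) |A|)) ⟩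
    ∑⟨ A ⟩ (λ _ → a)
      ≡⟨ ∑-const A a ⟩
    card A * a
      ≡⟨ trans (cong (_* a) |A|) (*-comm (suc a) a) ⟩
    a * suc a ∎
    where open ≡-Reasoning

Full : ∀ {m} → GraphOn m → VSet m → Set
Full H S = ∀ {v} → v ∈ S → 0 < deg H S v

-- Each vertex of `S` misses at least one of the `k` others, so `S` can serve as a class although it
-- has k + 1 vertices.
full-complement-sparse : ∀ {m} (G : GraphOn m) {k S} → card S ≡ suc k → Full (complement G) S →
  ∀ {v} → v ∈ S → deg G S v < k
full-complement-sparse G {k} |S| full {v} v∈S = s≤s⁻¹ (begin
  2 + deg G _ v                            ≡⟨ cong suc (+-comm 1 (deg G _ v)) ⟩
  suc (deg G _ v + 1)                      ≤⟨ s≤s (+-monoʳ-≤ (deg G _ v) (full v∈S)) ⟩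
  suc (deg G _ v + deg (complement G) _ v) ≡⟨ trans (deg-complement-∈ G v∈S) |S| ⟩
  suc k                                    ∎)
  where open ≤-Reasoning

-- With k = `suc κ`, the witness `c` is j / k rounded up: `c` blocks of size k cover `j` vertices,
-- overshoot by at most `κ`, and leave `r` levels.
ceiling : ∀ κ j R → j ≤ R * suc κ →
  ∃ λ c → ∃ λ r → c + r ≡ R × j ≤ c * suc κ × c * suc κ ≤ j + κ
ceiling κ j zero    le = 0 , 0 , refl , le , z≤n
ceiling κ j (suc R) le with j ≤? R * suc κ
... | no gt = suc R , 0 , +-identityʳ (suc R) , le ,
  ≤-trans (≤-reflexive (cong suc (+-comm κ _))) (+-monoˡ-≤ κ (≰⇒> gt))
... | yes le′ with ceiling κ j R le′
...   | c , r , refl , lo , hi = c , suc r , +-suc c r , lo , hi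

-- The lower bound on the volume of a losing set

module _ {m : ℕ} (G : GraphOn m) (κ : ℕ) where

  private
    k : ℕ
    k = suc κ

  -- At level r + 1 a vertex of degree at least (r + 1)k is deleted first. What remains loses at
  -- level r, and still does after κ - 1 more deletions, so κ further vertices of degree at least rk
  -- follow. This removes volume 2rk² + 2k, while `E` drops by 2rk² + k² + k; the difference is the
  -- error `k * κ` per level.
  crude : ∀ r {W} → ¬ Wins G k W r → E k r ≤ vol G W + r * (k * κ)
  crude zero    fails = z≤n
  crude (suc r) {W} fails with strip κ ≤-refl
    where
    strip : ∀ i → i ≤ κ → ∃ λ D → card D ≤ suc i ×
      vol G (W ∖ D) + 2 * (suc r * k) + i * (2 * (r * k)) ≤ vol G W
    strip zero le with lovász G k fails
    ... | v , v∈W , big = ｛ v ｝ , ≤-reflexive (card-｛｝ v) ,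
      ≤-trans (≤-reflexive (+-identityʳ _))
        (≤-trans (+-monoʳ-≤ _ (*-monoʳ-≤ 2 big)) (≤-reflexive (sym (vol-remove G v∈W))))
    strip (suc i) le with strip i (<⇒≤ le)
    ... | D , |D| , bound with lovász G k (fails ∘ wins-small-block G k (≤-trans |D| (s≤s (<⇒≤ le))))
    ... | v , v∈ , big = D ∪ ｛ v ｝ ,
      ≤-trans (≤-reflexive (card-insert (∖-∉ v∈))) (s≤s |D|) ,
      arith (vol G (W ∖ (D ∪ ｛ v ｝))) (vol G (W ∖ D)) (vol G ((W ∖ D) ∖ ｛ v ｝)) (vol G W)
        (deg G (W ∖ D) v) (2 * (suc r * k)) (r * k) i
        (vol-⊆ G λ p → ∖-∈ (∖-∈ (∖-∈ˡ p) (∖-∉ p ∘ ∪-∈ˡ)) (∖-∉ p ∘ ∪-∈ʳ))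
        (≤-reflexive (sym (vol-remove G v∈))) bound big
      where
      arith : ∀ x y z w d e s i → x ≤ z → z + 2 * d ≤ y → y + e + i * (2 * s) ≤ w → s ≤ d →
        x + e + suc i * (2 * s) ≤ w
      arith x y z w d e s i p q b c =
        ≤-certificate 0 (p ⊕ q ⊕ b ⊕ c ⊕ c) (solve (x ∷ y ∷ z ∷ w ∷ d ∷ e ∷ s ∷ i ∷ []))
  ... | D , |D| , bound = arith κ r (vol G (W ∖ D)) (vol G W) bound
          (crude r (fails ∘ wins-small-block G k |D|))
    where
    arith : ∀ κ r x w → x + 2 * (suc r * suc κ) + κ * (2 * (r * suc κ)) ≤ w →
      r * suc κ * suc (r * suc κ) ≤ x + r * (suc κ * κ) →
      suc r * suc κ * suc (suc r * suc κ) ≤ w + suc r * (suc κ * κ)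
    arith κ r x w p q = ≤-certificate 0 (p ⊕ q) (solve (κ ∷ r ∷ x ∷ w ∷ []))

  -- One level of the descent, set up for a contradiction: `σ` is the current deficit, `2 * γ` what
  -- a good deletion adds to it, and `descend` excludes every set that such a deletion would leave.
  module Step
    (r : ℕ) (W : VSet m) (σ γ : ℕ)
    (fails   : ¬ Wins G k W (suc r))
    (minDeg  : ∀ {v} → v ∈ W → suc r ≤ deg G W v)
    (volume  : vol G W + σ ≤ E k (suc r))
    (slack   : γ + 2 * (k * k) ≤ suc r)
    (descend : ∀ W′ → ¬ Wins G k W′ r → vol G W′ + (σ + 2 * γ) ≤ E k r → ⊥)
    (select  : ∀ A → card A ≡ suc (suc r * k) →
               (∀ S → S ⊆ A → card S ≡ suc k → Full (complement G) S → ⊥) → vol (complement G) A < σ)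
    where

    -- The tolerance `2 * κ` is what `highSet` loses: `κ` by rounding the number of blocks up, and
    -- `κ` by non-neighbours of the new vertex.
    High : VSet m
    High = W ∩ ⟪ (λ v → suc r * k ≤? deg G W v + 2 * κ) ⟫

    -- `S` may be one class, so the rest of `W` loses at level `r`. The degrees of the `k` high
    -- vertices account for the drop of `E` up to a multiple of k². The degree of `z`, at least
    -- `suc r`, counts twice and by `slack` pays for this error and for the gain `2 * γ`.
    remove : ∀ S {z} → z ∈ W → z ∈ S → S ∖ ｛ z ｝ ⊆ High → card S ≡ suc k → ¬ Full (complement G) S
    remove S {z} z∈W z∈S high |S| full = descend (W ∖ S)
      (fails ∘ wins-block G k sparse)
      (arith κ r γ σ (vol G W) (vol G S) (vol G (W ∖ S)) (cross G S W) (cross G (S ∖ ｛ z ｝) W) (deg G W z)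
        (≤-reflexive balance) volS (minDeg z∈W) others
        (≤-reflexive (sym degreeSum)) volume slack)
      where
      S⊆W : S ⊆ W
      S⊆W {v} v∈S with v ∈? ｛ z ｝
      ... | yes p = ｛｝-⊆ z∈W p
      ... | no p  = ∩-∈ˡ (high (∖-∈ v∈S p))
      sparse : ∀ {v} → v ∈ S → deg G S v < k
      sparse = full-complement-sparse G |S| full
      -- The pairs inside `S` occur twice in `2 * cross G S W`, which explains the extra `vol G S`.
      balance : vol G (W ∖ S) + 2 * cross G S W ≡ vol G W + vol G S
      balance = begin
        vol G (W ∖ S) + 2 * cross G S W
          ≡⟨ cong (λ x → vol G (W ∖ S) + 2 * x) (trans (∑-cong λ {v} _ → deg-split G v (∖-split S⊆W))
               (∑-add S (deg G S) (deg G (W ∖ S)))) ⟩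
        vol G (W ∖ S) + 2 * (vol G S + cross G S (W ∖ S))
          ≡⟨ rearrange (vol G (W ∖ S)) (vol G S) (cross G S (W ∖ S)) ⟩
        (vol G S + vol G (W ∖ S) + 2 * cross G S (W ∖ S)) + vol G S
          ≡⟨ cong (_+ vol G S) (vol-split G (∖-split S⊆W)) ⟨
        vol G W + vol G S ∎
        where
        open ≡-Reasoning
        rearrange : ∀ x y z → x + 2 * (y + z) ≡ (y + x + 2 * z) + y
        rearrange = solve-∀
      volS : vol G S ≤ suc k * κ
      volS = ≤-trans (∑-mono λ v∈S → s≤s⁻¹ (sparse v∈S))
        (≤-reflexive (trans (∑-const S κ) (cong (_* κ) |S|)))
      degreeSum : cross G S W ≡ deg G W z + cross G (S ∖ ｛ z ｝) W
      degreeSum = trans (∑-split (deg G W) (remove-split z∈S)) (cong (_+ cross G (S ∖ ｛ z ｝) W) (∑-｛｝ z (deg G W)))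
      others : k * (suc r * k) ≤ cross G (S ∖ ｛ z ｝) W + k * (2 * κ)
      others = begin
        k * (suc r * k)                                ≡⟨ cong (_* (suc r * k)) |B| ⟨
        card (S ∖ ｛ z ｝) * (suc r * k)                 ≡⟨ ∑-const (S ∖ ｛ z ｝) _ ⟨
        ∑⟨ S ∖ ｛ z ｝ ⟩ (λ _ → suc r * k)               ≤⟨ ∑-mono (λ v∈ → ⟪⟫-∈ (∩-∈ʳ (high v∈))) ⟩
        ∑⟨ S ∖ ｛ z ｝ ⟩ (λ v → deg G W v + 2 * κ)       ≡⟨ ∑-add (S ∖ ｛ z ｝) (deg G W) (λ _ → 2 * κ) ⟩
        cross G (S ∖ ｛ z ｝) W + ∑⟨ S ∖ ｛ z ｝ ⟩ (λ _ → 2 * κ)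
          ≡⟨ cong (cross G (S ∖ ｛ z ｝) W +_) (trans (∑-const (S ∖ ｛ z ｝) _) (cong (_* (2 * κ)) |B|)) ⟩
        cross G (S ∖ ｛ z ｝) W + k * (2 * κ)            ∎
        where
        open ≤-Reasoning
        |B| : card (S ∖ ｛ z ｝) ≡ k
        |B| = suc-injective (trans (sym (card-remove z∈S)) |S|)
      arith : ∀ κ r γ σ w s x c b d → let k = suc κ in
        x + 2 * c ≤ w + s → s ≤ suc k * κ → suc r ≤ d → k * (suc r * k) ≤ b + k * (2 * κ) →
        d + b ≤ c → w + σ ≤ suc r * k * suc (suc r * k) → γ + 2 * (k * k) ≤ suc r →
        x + (σ + 2 * γ) ≤ r * k * suc (r * k)
      -- `e`, `f`, `g` and `i` enter twice because a removed degree lowers the volume by twice its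
      -- value; 3k + 1 is left over.
      arith κ r γ σ w s x c b d p q e f g h i = ≤-certificate (3 * κ + 4)
        (p ⊕ q ⊕ e ⊕ e ⊕ f ⊕ f ⊕ g ⊕ g ⊕ h ⊕ i ⊕ i)
        (solve (κ ∷ r ∷ γ ∷ σ ∷ w ∷ s ∷ x ∷ c ∷ b ∷ d ∷ []))

    -- Together with `z`, any `k` of its high non-neighbours contain a spanning star in the
    -- complement. They form a full set of k + 1 vertices, all high except perhaps `z`, which
    -- `remove` excludes.
    few-non-neighbours : ∀ {z} → z ∈ W → deg (complement G) High z ≤ κ
    few-non-neighbours {z} z∈W = ≮⇒≥ λ many →
      let B , B⊆ , |B| = subsetOfSize (High ∩ nbr (complement G) z) k many
          B≁z : ∀ {v} → v ∈ B → v ∈ nbr (complement G) z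
          B≁z v∈B = ∩-∈ʳ (B⊆ v∈B)
          b , b∈B = card>0⇒∃ (subst (0 <_) (sym |B|) (s≤s z≤n))
          full : Full (complement G) (B ∪ ｛ z ｝)
          full p = case-full (∪-∈ p) B≁z b∈B
      in remove (B ∪ ｛ z ｝) z∈W (∪-∈ʳ self-∈) (λ p → drop (∪-∈ (∖-∈ˡ p)) (∖-∉ p) (∩-∈ˡ ∘ B⊆))
           (trans (card-insert λ z∈B → nbr-irrefl (complement G) (B≁z z∈B)) (cong suc |B|)) full
      where
      drop : ∀ {B v} → v ∈ B ⊎ v ∈ ｛ z ｝ → v ∉ ｛ z ｝ → B ⊆ High → v ∈ High
      drop (inj₁ v∈B) _ sub = sub v∈B
      drop (inj₂ v∈z) v∉z _ = ⊥-elim (v∉z v∈z)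
      case-full : ∀ {B v b} → v ∈ B ⊎ v ∈ ｛ z ｝ → (∀ {v} → v ∈ B → v ∈ nbr (complement G) z) → b ∈ B →
        0 < deg (complement G) (B ∪ ｛ z ｝) v
      case-full (inj₁ v∈B) B≁z b∈B = ∈⇒deg>0 (complement G) (∪-∈ʳ self-∈) (nbr-sym (complement G) (B≁z v∈B))
      case-full (inj₂ v∈z) B≁z b∈B rewrite ｛｝-∈ v∈z = ∈⇒deg>0 (complement G) (∪-∈ˡ b∈B) (B≁z b∈B)

    -- A set A of high-degree vertices grows: after removing A as ⌈|A|/k⌉ blocks, what is left
    -- contains a vertex of large degree, and this vertex is adjacent to almost all of A.
    highSet : ∀ j → j ≤ suc (suc r * k) → ∃ λ A → A ⊆ High × card A ≡ j
    highSet zero le = High ∖ High , ∖-∈ˡ , card-empty λ v p → ∖-∉ p (∖-∈ˡ p)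
    highSet (suc j) le with highSet j (<⇒≤ le) | ceiling κ j (suc r) (s≤s⁻¹ le)
    ... | A , A⊆ , |A| | c , r′ , eq , lo , hi
      with lovász G k (λ wins → fails (subst (Wins G k W) eq
             (wins-blocks G k c A (subst (_≤ c * k) (sym |A|) lo) wins)))
    ... | v , v∈ , big = A ∪ ｛ v ｝ , insert-⊆ A⊆ v∈High , trans (card-insert (∖-∉ v∈)) (cong suc |A|)
      where
      v∈W : v ∈ W
      v∈W = ∖-∈ˡ v∈
      arith : ∀ κ c r j a b d → c * suc κ ≤ j + κ → j ≤ a + b → b ≤ κ → r * suc κ ≤ d →
        (c + r) * suc κ ≤ (a + d) + 2 * κ
      arith κ c r j a b d p q e f = ≤-certificate 0 (p ⊕ q ⊕ e ⊕ f)
        (solve (κ ∷ c ∷ r ∷ j ∷ a ∷ b ∷ d ∷ []))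
      v∈High : v ∈ High
      v∈High = ∩-∈ v∈W (∈-⟪⟫ (subst₂ (λ x y → x * k ≤ y + 2 * κ) eq
        (sym (deg-split G v (∖-split (∩-∈ˡ ∘ A⊆))))
        (arith κ c r′ j (deg G A v) (deg (complement G) A v) _ hi
          (≤-reflexive (trans (sym |A|) (sym (deg-complement-∉ G (∖-∉ v∈)))))
          (≤-trans (deg-⊆ (complement G) v A⊆) (few-non-neighbours v∈W)) big)))

    -- `remove` rules out full sets inside `A`, so by `select` fewer than `σ` ordered pairs are
    -- missing there. Then `A` alone has more volume than `W` is allowed.
    no-highSet : ∀ A → A ⊆ High → card A ≡ suc (suc r * k) → ⊥
    no-highSet A A⊆ |A| = <-irrefl refl (begin-strict
      vol G W + σ                      ≤⟨ volume ⟩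
      E k (suc r)                      ≡⟨ vol-complement G A |A| ⟨
      vol G A + vol (complement G) A   <⟨ +-monoʳ-< (vol G A) (select A |A| noFull) ⟩
      vol G A + σ                      ≤⟨ +-monoˡ-≤ σ (vol-⊆ G λ p → ∩-∈ˡ (A⊆ p)) ⟩
      vol G W + σ                      ∎)
      where
      open ≤-Reasoning
      noFull : ∀ S → S ⊆ A → card S ≡ suc k → Full (complement G) S → ⊥
      noFull S S⊆A |S| full with card>0⇒∃ (subst (0 <_) (sym |S|) (s≤s z≤n))
      ... | z , z∈S = remove S (∩-∈ˡ (A⊆ (S⊆A z∈S))) z∈S (λ p → A⊆ (S⊆A (∖-∈ˡ p))) |S| full

    impossible : ⊥
    impossible =
      let A , A⊆ , |A| = highSet (suc (suc r * k)) ≤-refl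
      in no-highSet A A⊆ |A|

  -- Isolates the dependence on the parity of `k`: the rest of the lower bound is uniform, and
  -- `selection-odd` and `selection-even` supply `t`.
  Selection : ℕ → ℕ → Set
  Selection R t = ∀ s A → s ≤ R → card A ≡ suc (s * k) →
    (∀ S → S ⊆ A → card S ≡ suc k → Full (complement G) S → ⊥) → vol (complement G) A ≤ t

  -- Induction on `q`, the number of levels above the bottom level `r`. Each level gains `2 * γ`,
  -- and `gain` says that the deficit at the bottom beats the error of `crude`. `slack` at the
  -- bottom implies it at every level above.
  descent : ∀ R t γ → Selection R t → ∀ q r W σ → q + r ≤ R → γ + 2 * (k * k) ≤ suc r → t < σ →
    r * (k * κ) < σ + q * (2 * γ) → ¬ Wins G k W (q + r) → vol G W + σ ≤ E k (q + r) → ⊥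
  descent R t γ select zero r W σ le slack t<σ gain fails volume = <-irrefl refl (begin-strict
    vol G W + r * (k * κ)  <⟨ +-monoʳ-< (vol G W) (subst (r * (k * κ) <_) (+-identityʳ σ) gain) ⟩
    vol G W + σ            ≤⟨ volume ⟩
    E k r                  ≤⟨ crude r fails ⟩
    vol G W + r * (k * κ)  ∎)
    where open ≤-Reasoning
  descent R t γ select (suc q) r W σ le slack t<σ gain fails volume
    with peel G k _ W (s≤s z≤n) ≤-refl fails
  ... | W′ , W′⊆W , fails′ , minDeg = Step.impossible (q + r) W′ σ γ fails′ minDeg
    (≤-trans (+-monoˡ-≤ σ (vol-⊆ G W′⊆W)) volume)
    (≤-trans slack (s≤s (m≤n+m r q)))
    (λ W″ → descent R t γ select q r W″ (σ + 2 * γ) (<⇒≤ le) slack (≤-trans t<σ (m≤m+n σ _))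
      (≤-trans gain (≤-reflexive (sym (+-assoc σ (2 * γ) (q * (2 * γ)))))))
    (λ A |A| noFull → ≤-<-trans (select (suc (q + r)) A le |A| noFull) t<σ)

  vol-lower-bound : ∀ R t W → k * k * k + 2 * (k * k) ≤ R → Selection R t →
    ¬ Wins G k W R → E k R ≤ vol G W + t
  vol-lower-bound R t W big select fails = ≮⇒≥ λ small →
    -- The bound is assumed to fail by at least one, hence the initial deficit `suc t`. Of the `R`
    -- levels, k² are descended; the bottom 2k² + γ is the least that `slack` needs, up to one. The
    -- cubic bound on `R` makes γ at least k²κ, and then k² gains of 2γ cover the crude error.
    descent R t γ select (k * k) (2 * (k * k) + γ) W (suc t) (≤-reflexive (sym levels))
      (≤-trans (≤-reflexive (+-comm γ _)) (n≤1+n _)) ≤-refl (s≤s (≤-trans (gain κ γ″) (m≤n+m _ t)))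
      (subst (λ s → ¬ Wins G k W s) levels fails)
      (subst (λ s → vol G W + suc t ≤ E k s) levels (≤-trans (≤-reflexive (+-suc (vol G W) t)) small))
    where
    γ″ = proj₁ (m≤n⇒∃[o]m+o≡n big)
    γ = k * k * κ + γ″
    levels : R ≡ k * k + (2 * (k * k) + γ)
    levels = trans (sym (proj₂ (m≤n⇒∃[o]m+o≡n big))) (rearrange κ γ″)
      where
      rearrange : ∀ κ g → let k = suc κ in
        k * k * k + 2 * (k * k) + g ≡ k * k + (2 * (k * k) + (k * k * κ + g))
      rearrange = solve-∀
    gain : ∀ κ g → let k = suc κ ; γ = k * k * κ + g in
      (2 * (k * k) + γ) * (k * κ) ≤ k * k * (2 * γ)
    gain κ g = ≤-certificate (suc κ * suc κ * suc κ * κ * κ + g * suc κ * (suc κ + 1)) (z≤n {0})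
      (solve (κ ∷ g ∷ []))

-- Graphs without a full set of k + 1 vertices

module _ {m : ℕ} (H : GraphOn m) where

  -- Deleting a vertex lowers the volume by twice its degree.
  vol-even : ∀ n A → card A ≡ n → ∃ λ e → vol H A ≡ 2 * e
  vol-even zero    A |A| = 0 , n≤0⇒n≡0 (≤-trans
    (∑-mono λ v∈A → ≤-trans (<⇒≤ (deg<card H v∈A)) (≤-reflexive |A|))
    (≤-reflexive (trans (∑-const A 0) (*-zeroʳ (card A)))))
  vol-even (suc n) A |A| with card>0⇒∃ (subst (0 <_) (sym |A|) (s≤s z≤n))
  ... | v , v∈A with vol-even n (A ∖ ｛ v ｝) (suc-injective (trans (sym (card-remove v∈A)) |A|))
  ... | e , eq = e + deg H A v ,
    trans (vol-remove H v∈A) (trans (cong (_+ 2 * deg H A v) eq) (sym (*-distribˡ-+ 2 e (deg H A v))))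

  full-insert : ∀ {U x w} → Full H U → w ∈ U → w ∈ nbr H x → Full H (U ∪ ｛ x ｝)
  full-insert full w∈U w~x p with ∪-∈ p
  ... | inj₁ v∈U = ≤-trans (full v∈U) (deg-⊆ H _ ∪-∈ˡ)
  ... | inj₂ v∈x rewrite ｛｝-∈ v∈x = ∈⇒deg>0 H (∪-∈ˡ w∈U) w~x

  full-insert-edge : ∀ {U x w} → Full H U → w ∈ nbr H x → Full H ((U ∪ ｛ x ｝) ∪ ｛ w ｝)
  full-insert-edge full w~x p with ∪-∈ p
  ... | inj₂ v∈w rewrite ｛｝-∈ v∈w = ∈⇒deg>0 H (∪-∈ˡ (∪-∈ʳ self-∈)) (nbr-sym H w~x)
  ... | inj₁ q with ∪-∈ q
  ...   | inj₁ v∈U = ≤-trans (full v∈U) (deg-⊆ H _ (∪-∈ˡ ∘ ∪-∈ˡ))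
  ...   | inj₂ v∈x rewrite ｛｝-∈ v∈x = ∈⇒deg>0 H (∪-∈ʳ self-∈) w~x

  full-｛｝∪ : ∀ {x w} → w ∈ nbr H x → Full H (｛ x ｝ ∪ ｛ w ｝)
  full-｛｝∪ w~x p with ∪-∈ p
  ... | inj₁ v∈x rewrite ｛｝-∈ v∈x = ∈⇒deg>0 H (∪-∈ʳ self-∈) w~x
  ... | inj₂ v∈w rewrite ｛｝-∈ v∈w = ∈⇒deg>0 H (∪-∈ˡ self-∈) (nbr-sym H w~x)

  -- Delete a neighbour a of c, or else a vertex hanging on a alone.
  full-shrink : ∀ {U c a b} → Full H U → c ∈ U → a ∈ U → b ∈ U → a ∈ nbr H c → b ∈ nbr H c → ¬ b ≡ a →
    ∃ λ ℓ → ℓ ∈ U × Full H (U ∖ ｛ ℓ ｝)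
  full-shrink {U} {c} {a} {b} full c∈U a∈U b∈U a~c b~c b≢a
    with find (λ ℓ → (ℓ ∈? (U ∖ ｛ a ｝)) ×-dec (deg H (U ∖ ｛ a ｝) ℓ ≟ℕ 0))
  ... | inj₂ none = a , a∈U , λ {v} v∈ → n≢0⇒n>0 λ iso → none v (v∈ , iso)
  ... | inj₁ (ℓ , ℓ∈ , isolated) = ℓ , ∖-∈ˡ ℓ∈ , full′
    where
    c≢ℓ : c ∉ ｛ ℓ ｝
    c≢ℓ p = <-irrefl refl (subst (0 <_) (subst (λ x → deg H (U ∖ ｛ a ｝) x ≡ 0) (sym (｛｝-∈ p)) isolated)
      (∈⇒deg>0 H (∖-∈ b∈U (b≢a ∘ ｛｝-∈)) b~c))
    full′ : Full H (U ∖ ｛ ℓ ｝)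
    full′ {v} v∈ with v ∈? ｛ a ｝ | deg>0⇒∃ H (full (∖-∈ˡ v∈))
    ... | yes v∈a | _ rewrite ｛｝-∈ v∈a = ∈⇒deg>0 H (∖-∈ c∈U c≢ℓ) (nbr-sym H a~c)
    ... | no v∉a | u , u∈U , u~v with u ∈? ｛ ℓ ｝
    ...   | no u∉ℓ  = ∈⇒deg>0 H (∖-∈ u∈U u∉ℓ) u~v
    ...   | yes u∈ℓ = ⊥-elim (<-irrefl refl (subst (0 <_) isolated
      (∈⇒deg>0 H (∖-∈ (∖-∈ˡ v∈) v∉a) (subst (λ x → v ∈ nbr H x) (｛｝-∈ u∈ℓ) (nbr-sym H u~v)))))

module _ {m : ℕ} (H : GraphOn m) (κ : ℕ) (κ>0 : 0 < κ) (A : VSet m)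
  (noFull : ∀ S → S ⊆ A → card S ≡ suc (suc κ) → Full H S → ⊥) where

  private
    k : ℕ
    k = suc κ

    X : VSet m
    X = A ∩ ⟪ (λ v → 0 <? deg H A v) ⟫

    Extends : VSet m → VSet m → Set
    Extends U U′ = U ⊆ U′ × U′ ⊆ A × Full H U′

  -- All edges lie inside `X`, so degrees are at most `κ`. The complete graph on `k` vertices is the
  -- extremal case.
  vol-few-non-isolated : card X ≤ k → vol H A ≤ k * κ
  vol-few-non-isolated few = begin
    vol H A                                       ≡⟨ ∑-split (deg H A) (∖-split ∩-∈ˡ) ⟩
    ∑⟨ X ⟩ (deg H A) + ∑⟨ A ∖ X ⟩ (deg H A)        ≤⟨ +-mono-≤ (∑-mono inX) (∑-mono outX) ⟩
    ∑⟨ X ⟩ (λ _ → κ) + ∑⟨ A ∖ X ⟩ (λ _ → 0)        ≡⟨ cong₂ _+_ (∑-const X κ) (∑-const (A ∖ X) 0) ⟩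
    card X * κ + card (A ∖ X) * 0                 ≡⟨ cong (card X * κ +_) (*-zeroʳ (card (A ∖ X))) ⟩
    card X * κ + 0                                ≡⟨ +-identityʳ _ ⟩
    card X * κ                                    ≤⟨ *-monoˡ-≤ κ few ⟩
    k * κ                                         ∎
    where
    open ≤-Reasoning
    outX : ∀ {v} → v ∈ A ∖ X → deg H A v ≤ 0
    outX v∈ = ≮⇒≥ λ pos → ∖-∉ v∈ (∩-∈ (∖-∈ˡ v∈) (∈-⟪⟫ pos))
    inX : ∀ {v} → v ∈ X → deg H A v ≤ κ
    inX {v} v∈X = s≤s⁻¹ (≤-trans (s≤s (card-⊆ λ p → ∩-∈
        (∩-∈ (∩-∈ˡ p) (∈-⟪⟫ (∈⇒deg>0 H (∩-∈ˡ v∈X) (nbr-sym H (∩-∈ʳ p))))) (∩-∈ʳ p)))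
      (≤-trans (deg<card H v∈X) few))

  module _ (many : k < card X) where

    -- More than `k` vertices are not isolated, so one of them lies outside `U`; its neighbour `w`
    -- may still belong to `U`.
    newEdge : ∀ U → card U ≤ k → ∃ λ x → x ∈ A × x ∉ U × ∃ λ w → w ∈ A × w ∈ nbr H x
    newEdge U le with card<⇒∃ (≤-<-trans le many)
    ... | x , x∈X , x∉U with deg>0⇒∃ H (⟪⟫-∈ (∩-∈ʳ x∈X))
    ... | w , w∈A , w~x = x , ∩-∈ˡ x∈X , x∉U , w , w∈A , w~x

    -- A new vertex with a neighbour in `U` adds one vertex, an edge disjoint from `U` adds two.
    -- Only the latter could jump from k - 1 to k + 1, and `noFull` forbids that.
    grow : ∀ d U → d + card U ≡ k → U ⊆ A → Full H U → ∃ λ U′ → Extends U U′ × card U′ ≡ k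
    grow zero    U eq U⊆A full = U , ((λ p → p) , U⊆A , full) , eq
    grow (suc d) U eq U⊆A full with newEdge U (≤-trans (m≤n+m (card U) (suc d)) (≤-reflexive eq))
    ... | x , x∈A , x∉U , w , w∈A , w~x with find (λ u → u ∈? (U ∩ nbr H x))
    ...   | inj₁ (u , u∈)
      with grow d (U ∪ ｛ x ｝) (trans (cong (d +_) (card-insert x∉U)) (trans (+-suc d (card U)) eq))
             (insert-⊆ U⊆A x∈A) (full-insert H full (∩-∈ˡ u∈) (∩-∈ʳ u∈))
    ...     | U′ , (sub , rest) , |U′| = U′ , (sub ∘ ∪-∈ˡ , rest) , |U′|
    grow (suc d) U eq U⊆A full | x , x∈A , x∉U , w , w∈A , w~x | inj₂ none = finish d eq
      where
      U₂ : VSet m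
      U₂ = (U ∪ ｛ x ｝) ∪ ｛ w ｝
      w∉ : w ∉ U ∪ ｛ x ｝
      w∉ p with ∪-∈ p
      ... | inj₁ w∈U = none w (∩-∈ w∈U w~x)
      ... | inj₂ w∈x = nbr-irrefl H (subst (_∈ nbr H x) (｛｝-∈ w∈x) w~x)
      |U₂| : card U₂ ≡ 2 + card U
      |U₂| = trans (card-insert w∉) (cong suc (card-insert x∉U))
      U₂⊆A : U₂ ⊆ A
      U₂⊆A = insert-⊆ (insert-⊆ U⊆A x∈A) w∈A
      finish : ∀ d → suc d + card U ≡ k → ∃ λ U′ → Extends U U′ × card U′ ≡ k
      finish zero    eq = ⊥-elim (noFull U₂ U₂⊆A (trans |U₂| (cong suc eq)) (full-insert-edge H full w~x))
      finish (suc d) eq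
        with grow d U₂ (trans (cong (d +_) |U₂|) (trans (+-suc d _) (trans (cong suc (+-suc d _)) eq)))
               U₂⊆A (full-insert-edge H full w~x)
      ... | U′ , (sub , rest) , |U′| = U′ , (sub ∘ ∪-∈ˡ ∘ ∪-∈ˡ , rest) , |U′|

    -- Two neighbours of `c` in `U` allow one vertex to be dropped without isolating another. An
    -- edge at a vertex outside `U` then completes a full set of k + 1 vertices: `U` and one new
    -- vertex, or the shrunken set and two.
    exchange : ∀ {U c a b} → U ⊆ A → Full H U → card U ≡ k → c ∈ U → a ∈ U → b ∈ U →
      a ∈ nbr H c → b ∈ nbr H c → ¬ b ≡ a → ⊥
    exchange {U} U⊆A full |U| c∈U a∈U b∈U a~c b~c b≢a
      with newEdge U (≤-reflexive |U|) | full-shrink H full c∈U a∈U b∈U a~c b~c b≢a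
    ... | x , x∈A , x∉U , w , w∈A , w~x | ℓ , ℓ∈U , full′ with w ∈? U
    ...   | yes w∈U = noFull (U ∪ ｛ x ｝) (insert-⊆ U⊆A x∈A) (trans (card-insert x∉U) (cong suc |U|))
      (full-insert H full w∈U w~x)
    ...   | no w∉U = noFull (((U ∖ ｛ ℓ ｝) ∪ ｛ x ｝) ∪ ｛ w ｝) (insert-⊆ (insert-⊆ (U⊆A ∘ ∖-∈ˡ) x∈A) w∈A)
      (trans (card-insert w∉) (cong suc (trans (card-insert (x∉U ∘ ∖-∈ˡ)) (trans (sym (card-remove ℓ∈U)) |U|))))
      (full-insert-edge H full′ w~x)
      where
      w∉ : w ∉ (U ∖ ｛ ℓ ｝) ∪ ｛ x ｝
      w∉ p with ∪-∈ p
      ... | inj₁ w∈U = w∉U (∖-∈ˡ w∈U)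
      ... | inj₂ w∈x = nbr-irrefl H (subst (_∈ nbr H x) (｛｝-∈ w∈x) w~x)

    -- Two edges at `c` span a full set of three vertices. For k = 2 it is itself forbidden;
    -- otherwise it grows to `k` vertices and `exchange` applies.
    matching : ∀ {v} → v ∈ A → deg H A v ≤ 1
    matching {c} c∈A = ≮⇒≥ λ big →
      let P , P⊆ , |P| = subsetOfSize (A ∩ nbr H c) 2 big
          a , a∈P = card>0⇒∃ (subst (0 <_) (sym |P|) (s≤s z≤n))
          b , b∈P∖a = card>0⇒∃ (subst (0 <_) (suc-injective (trans (sym |P|) (card-remove a∈P))) (s≤s z≤n))
      in cherry (P⊆ a∈P) (P⊆ (∖-∈ˡ b∈P∖a)) λ b≡a → ∖-∉ b∈P∖a (subst (_∈ ｛ a ｝) (sym b≡a) self-∈)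
      where
      cherry : ∀ {a b} → a ∈ A ∩ nbr H c → b ∈ A ∩ nbr H c → ¬ b ≡ a → ⊥
      cherry {a} {b} a∈ b∈ b≢a = finish (k ≤? 2)
        where
        U : VSet m
        U = (｛ c ｝ ∪ ｛ a ｝) ∪ ｛ b ｝
        c≢ : ∀ {u} → u ∈ nbr H c → u ∉ ｛ c ｝
        c≢ u~c u∈c = nbr-irrefl H (subst (_∈ nbr H c) (｛｝-∈ u∈c) u~c)
        b∉ : b ∉ ｛ c ｝ ∪ ｛ a ｝
        b∉ p with ∪-∈ p
        ... | inj₁ q = c≢ (∩-∈ʳ b∈) q
        ... | inj₂ q = b≢a (｛｝-∈ q)
        |U| : card U ≡ 3
        |U| = trans (card-insert b∉) (cong suc (trans (card-insert (c≢ (∩-∈ʳ a∈))) (cong suc (card-｛｝ c))))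
        full : Full H U
        full = full-insert H (full-｛｝∪ H (∩-∈ʳ a∈)) (∪-∈ˡ self-∈) (nbr-sym H (∩-∈ʳ b∈))
        U⊆A : U ⊆ A
        U⊆A = insert-⊆ (insert-⊆ (｛｝-⊆ c∈A) (∩-∈ˡ a∈)) (∩-∈ˡ b∈)
        finish : Dec (k ≤ 2) → ⊥
        finish (yes k≤2) = noFull U U⊆A (trans |U| (cong suc (≤-antisym (s≤s κ>0) k≤2))) full
        finish (no k>2) with m≤n⇒∃[o]m+o≡n (≰⇒> k>2)
        ... | d , eq with grow d U (trans (cong (d +_) |U|) (trans (+-comm d 3) eq)) U⊆A full
        ...   | U′ , (sub , U′⊆A , full′) , |U′| = exchange U′⊆A full′ |U′|
          (sub (∪-∈ˡ (∪-∈ˡ self-∈))) (sub (∪-∈ˡ (∪-∈ʳ self-∈))) (sub (∪-∈ʳ self-∈)) (∩-∈ʳ a∈) (∩-∈ʳ b∈) b≢a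

    perfectMatching : ∃ λ U → card U ≡ k × vol H U ≡ k
    -- `A ∖ A` stands for the empty set: any edge will do as a start.
    perfectMatching with newEdge (A ∖ A) (≤-trans (≤-reflexive (card-empty λ v p → ∖-∉ p (∖-∈ˡ p))) z≤n)
      | m≤n⇒∃[o]m+o≡n κ>0
    ... | x , x∈A , _ , w , w∈A , w~x | d , refl
      with grow d (｛ x ｝ ∪ ｛ w ｝) (trans (cong (d +_) |xw|) (+-comm d 2))
             (insert-⊆ (｛｝-⊆ x∈A) w∈A) (full-｛｝∪ H w~x)
      where
      |xw| : card (｛ x ｝ ∪ ｛ w ｝) ≡ 2
      |xw| = trans (card-insert λ w∈x → nbr-irrefl H (subst (_∈ nbr H x) (｛｝-∈ w∈x) w~x)) (cong suc (card-｛｝ x))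
    ... | U , (_ , U⊆A , full) , |U| = U , |U| , trans
      (∑-cong λ v∈U → ≤-antisym (≤-trans (deg-⊆ H _ U⊆A) (matching (U⊆A v∈U))) (full v∈U))
      (trans (card-∑ U) |U|)

  -- With more than `k` non-isolated vertices, `perfectMatching` would give a set of odd volume `k`.
  selection-odd : ∀ h → k ≡ suc (2 * h) → vol H A ≤ k * κ
  selection-odd h odd with card X ≤? k
  ... | yes few = vol-few-non-isolated few
  ... | no many with perfectMatching (≰⇒> many)
  ... | U , _ , volU with vol-even H _ U refl
  ... | e , even = ⊥-elim (even≢odd e h (trans (sym even) (trans volU odd)))

  -- With more than `k` non-isolated vertices the graph is a matching on an odd number `s * k + 1`
  -- of vertices, so one of them is unmatched.
  selection-even : ∀ h s R → k ≡ 2 * h → card A ≡ suc (s * k) → s ≤ R → κ ≤ R → vol H A ≤ R * k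
  selection-even h s R even |A| s≤R κ≤R with card X ≤? k
  ... | yes few = ≤-trans (vol-few-non-isolated few) (≤-trans (*-monoʳ-≤ k κ≤R) (≤-reflexive (*-comm k R)))
  ... | no many with vol-even H _ A refl
  ... | e , eq = ≤-trans (s≤s⁻¹ (≤∧≢⇒< volA λ odd → even≢odd e (s * h)
          (trans (sym eq) (trans odd (cong suc halve))))) (*-monoˡ-≤ k s≤R)
    where
    volA : vol H A ≤ suc (s * k)
    volA = ≤-trans (∑-mono (matching (≰⇒> many))) (≤-reflexive (trans (card-∑ A) |A|))
    halve : s * k ≡ 2 * (s * h)
    halve = trans (cong (s *_) even) (trans (sym (*-assoc s 2 h)) (trans (cong (_* h) (*-comm s 2)) (*-assoc 2 s h)))

-- Passage to the graphs, edge counts and colourings of the statement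

toGraph : ∀ {m} → GraphOn m → Graph
toGraph {m} G = record
  { V          = m
  ; adj        = nbr G
  ; adj-sym    = nbr-≡ G
  ; adj-irrefl = λ v → value-∉ {A = nbr G v} (nbr-irrefl G)
  }

fromGraph : (F : Graph) → GraphOn (V F)
fromGraph F = record
  { nbr        = adj F
  ; nbr-sym    = λ {u} {v} p → mem (trans (adj-sym F u v) (holds p))
  ; nbr-irrefl = λ {v} p → false≢true (trans (sym (adj-irrefl F v)) (holds p))
  }
  where
  false≢true : ¬ false ≡ true
  false≢true ()

sum-allFin : ∀ {m} (f : Fin m → ℕ) → ListAction.sum (List.map f (List.allFin m)) ≡ sum f
sum-allFin f = trans (cong ListAction.sum (map-tabulate (λ i → i) f)) (go f)
  where
  go : ∀ {m} (f : Fin m → ℕ) → ListAction.sum (List.tabulate f) ≡ sum f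
  go {zero}  f = refl
  go {suc m} f = cong (f zero +_) (go (f ∘ suc))

countFin-sum : ∀ m (p : Fin m → Bool) → countFin m p ≡ sum (λ i → ⟦ p i ⟧)
countFin-sum m p = trans (sum-allFin (λ i → if p i then 1 else 0)) (sum-cong-≗ λ i → if-⟦⟧ (p i))
  where
  if-⟦⟧ : ∀ b → (if b then 1 else 0) ≡ ⟦ b ⟧
  if-⟦⟧ true  = refl
  if-⟦⟧ false = refl

opaque
  unfolding card
  -- `edges` counts each edge at its smaller end; the transposed sum counts it at the larger.
  handshake : ∀ F → 2 * edges F ≡ vol (fromGraph F) everything
  handshake F = begin
    2 * edges F
      ≡⟨ cong (edges F +_) (+-identityʳ (edges F)) ⟩
    edges F + edges F
      ≡⟨ cong₂ _+_ edges-sum edges-sum ⟩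
    ascending + ascending
      ≡⟨ cong (ascending +_) (∑-comm λ i j → ⟦ (toℕ i <ᵇ toℕ j) ∧ adj F i j ⟧) ⟩
    ascending + sum (λ i → sum λ j → ⟦ (toℕ j <ᵇ toℕ i) ∧ adj F j i ⟧)
      ≡⟨ ∑-distrib-+ {V F} _ _ ⟨
    sum (λ i → sum (λ j → ⟦ (toℕ i <ᵇ toℕ j) ∧ adj F i j ⟧) + sum (λ j → ⟦ (toℕ j <ᵇ toℕ i) ∧ adj F j i ⟧))
      ≡⟨ sum-cong-≗ (λ i → trans (sym (∑-distrib-+ {V F} _ _)) (sum-cong-≗ (λ j → one-order i j))) ⟩
    sum (λ i → sum λ j → ⟦ adj F i j ⟧)
      ≡⟨ sum-cong-≗ {V F} (λ i → +-identityʳ _) ⟨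
    vol (fromGraph F) everything ∎
    where
    open ≡-Reasoning
    ascending : ℕ
    ascending = sum (λ i → sum λ j → ⟦ (toℕ i <ᵇ toℕ j) ∧ adj F i j ⟧)
    edges-sum : edges F ≡ sum (λ i → sum λ j → ⟦ (toℕ i <ᵇ toℕ j) ∧ adj F i j ⟧)
    edges-sum = trans (sum-allFin (λ i → countFin (V F) (λ j → (toℕ i <ᵇ toℕ j) ∧ adj F i j)))
      (sum-cong-≗ λ i → countFin-sum (V F) λ j → (toℕ i <ᵇ toℕ j) ∧ adj F i j)
    one-order : ∀ i j → ⟦ (toℕ i <ᵇ toℕ j) ∧ adj F i j ⟧ + ⟦ (toℕ j <ᵇ toℕ i) ∧ adj F j i ⟧ ≡ ⟦ adj F i j ⟧
    one-order i j rewrite adj-sym F j i with adj F i j in eq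
    ... | false rewrite ∧-zeroʳ (toℕ i <ᵇ toℕ j) | ∧-zeroʳ (toℕ j <ᵇ toℕ i) = refl
    ... | true rewrite ∧-identityʳ (toℕ i <ᵇ toℕ j) | ∧-identityʳ (toℕ j <ᵇ toℕ i) =
      compare (toℕ i) (toℕ j) λ i≡j → true≢false
        (trans (sym eq) (subst (λ x → adj F i x ≡ false) (toℕ-injective i≡j) (adj-irrefl F i)))
      where
      true≢false : ¬ true ≡ false
      true≢false ()
      compare : ∀ a b → ¬ a ≡ b → ⟦ a <ᵇ b ⟧ + ⟦ b <ᵇ a ⟧ ≡ 1
      compare zero    zero    ne = ⊥-elim (ne refl)
      compare zero    (suc b) ne = refl
      compare (suc a) zero    ne = refl
      compare (suc a) (suc b) ne = compare a b (ne ∘ cong suc)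

card-injection : ∀ {a m} {A : VSet m} (φ : Fin a → Fin m) → Injective _≡_ _≡_ φ → (∀ i → φ i ∈ A) → a ≤ card A
card-injection {zero}  φ inj into = z≤n
card-injection {suc a} {A = A} φ inj into = ≤-trans
  (s≤s (card-injection (φ ∘ suc) (λ {i} {j} e → suc-injectiveꟳ (inj {suc i} {suc j} e))
    λ i → ∖-∈ (into (suc i)) λ p → 0≢1+nꟳ (sym (inj {suc i} {zero} (｛｝-∈ p)))))
  (≤-reflexive (sym (card-remove (into zero))))

enumerate : ∀ {m} a {A : VSet m} → a ≤ card A →
  Σ (Fin a → Fin m) λ φ → Injective _≡_ _≡_ φ × (∀ i → φ i ∈ A)
enumerate zero    le = (λ ()) , (λ { {()} }) , λ ()
enumerate {m} (suc a) {A} le with card>0⇒∃ (≤-trans (s≤s z≤n) le)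
... | v , v∈A with enumerate a (s≤s⁻¹ (≤-trans le (≤-reflexive (card-remove v∈A))))
... | φ , inj , into = φ′ , inj′ , into′
  where
  φ′ : Fin (suc a) → Fin m
  φ′ zero    = v
  φ′ (suc i) = φ i
  φi≢v : ∀ i → ¬ φ i ≡ v
  φi≢v i e = ∖-∉ (into i) (subst (_∈ ｛ v ｝) (sym e) self-∈)
  inj′ : Injective _≡_ _≡_ φ′
  inj′ {zero}  {zero}  e = refl
  inj′ {zero}  {suc j} e = ⊥-elim (φi≢v j (sym e))
  inj′ {suc i} {zero}  e = ⊥-elim (φi≢v i e)
  inj′ {suc i} {suc j} e = cong suc (inj e)
  into′ : ∀ i → φ′ i ∈ A
  into′ zero    = v∈A
  into′ (suc i) = ∖-∈ˡ (into i)

complete-adj : ∀ {n} {i j : Fin n} → ¬ i ≡ j → adj (complete n) i j ≡ true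
complete-adj {i = i} {j} i≢j with i ≟ j
... | yes e = ⊥-elim (i≢j e)
... | no _  = refl

complete-adj⁻¹ : ∀ {n} {i j : Fin n} → adj (complete n) i j ≡ true → ¬ i ≡ j
complete-adj⁻¹ {i = i} {j} p i≡j with i ≟ j
complete-adj⁻¹ () _  | yes _
... | no h = h i≡j

-- A red star would give its centre `k` neighbours in its own class; a blue clique would map its R +
-- 1 vertices injectively to `R` colours.
arrows⇒¬wins : ∀ F k R → Arrows F (star k) (complete (suc R)) → ¬ Wins (fromGraph F) k everything R
arrows⇒¬wins F k R arrows (f , ok) = [ red , blue ]′ (arrows col)
  where
  class-sym : ∀ u v → colourClass f (f u) v ≡ colourClass f (f v) u
  class-sym u v = ⇔→≡ (mk⇔ swap swap)
    where
    swap : ∀ {u v} → colourClass f (f u) v ≡ true → colourClass f (f v) u ≡ true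
    swap p = holds {A = colourClass f _} (∈-⟪⟫ (sym (⟪⟫-∈ (mem p))))
  col : Colouring F
  col = (λ u → colourClass f (f u)) , class-sym
  red : ¬ MonoCopy F col true (star k)
  red (φ , inj , copy) = <-irrefl refl (≤-<-trans
    (card-injection (φ ∘ suc) (λ {i} {j} e → suc-injectiveꟳ (inj {suc i} {suc j} e)) λ i →
      let edge , colour = copy zero (suc i) refl
      in ∩-∈ everything-∈ (∩-∈ (mem edge) (mem colour)))
    (proj₂ (ok everything-∈)))
  blue : ¬ MonoCopy F col false (complete (suc R))
  blue (φ , inj , copy) = <-irrefl refl (injective⇒≤ {f = g} λ {i} {j} → g-injective i j)
    where
    g : Fin (suc R) → Fin R
    g i = fromℕ< (proj₁ (ok {φ i} everything-∈))
    g-injective : ∀ i j → g i ≡ g j → i ≡ j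
    g-injective i j e with i ≟ j
    ... | yes p = p
    ... | no i≢j = ⊥-elim (true≢false (trans
      (sym (holds {A = colourClass f (f (φ i))} (∈-⟪⟫ (sym (fromℕ<-injective _ _ _ _ e)))))
      (proj₂ (copy i j (complete-adj i≢j)))))
      where
      true≢false : ¬ true ≡ false
      true≢false ()

-- Greedy independent sets

Independent : ∀ {m} → GraphOn m → VSet m → Set
Independent H I = ∀ {u v} → u ∈ I → v ∈ I → u ∉ nbr H v

module _ {m : ℕ} (H : GraphOn m) (κ : ℕ) where

  private
    k : ℕ
    k = suc κ

  LargeIndependent : VSet m → Set
  LargeIndependent W = ∃ λ I → I ⊆ W × Independent H I × card W ≤ k * card I

  rest : VSet m → Fin m → VSet m
  rest W v = (W ∖ ｛ v ｝) ∖ nbr H v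

  card-rest : ∀ {W v} → v ∈ W → card W ≡ suc (deg H W v + card (rest W v))
  card-rest {W} {v} v∈W = trans (card-remove v∈W) (cong suc
    (trans (card-split (∩-∖-split (W ∖ ｛ v ｝) (nbr H v))) (cong (_+ card (rest W v)) (sym (deg-remove H v∈W)))))

  -- The size bound is a separate hypothesis because it has two sources: a low degree of `v`, or
  -- parity in the even case.
  addIndependent : ∀ {W v} → v ∈ W → (large : LargeIndependent (rest W v)) →
    card W ≤ k + k * card (proj₁ large) → LargeIndependent W
  addIndependent {W} {v} v∈W (I , I⊆ , indep , _) le = I ∪ ｛ v ｝ ,
    insert-⊆ (∖-∈ˡ ∘ ∖-∈ˡ ∘ I⊆) v∈W , indep′ ,
    ≤-trans le (≤-reflexive (trans (sym (*-suc k (card I))) (cong (k *_) (sym (card-insert v∉I)))))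
    where
    v∉I : v ∉ I
    v∉I v∈I = ∖-∉ (∖-∈ˡ (I⊆ v∈I)) self-∈
    indep′ : Independent H (I ∪ ｛ v ｝)
    indep′ p q u~w with ∪-∈ p | ∪-∈ q
    ... | inj₁ u∈I | inj₁ w∈I = indep u∈I w∈I u~w
    ... | inj₁ u∈I | inj₂ w∈v rewrite ｛｝-∈ w∈v = ∖-∉ (I⊆ u∈I) u~w
    ... | inj₂ u∈v | inj₁ w∈I rewrite ｛｝-∈ u∈v = ∖-∉ (I⊆ w∈I) (nbr-sym H u~w)
    ... | inj₂ u∈v | inj₂ w∈v rewrite ｛｝-∈ u∈v | ｛｝-∈ w∈v = nbr-irrefl H u~w

  addLowDegree : ∀ {W v} → v ∈ W → deg H W v ≤ κ → LargeIndependent (rest W v) → LargeIndependent W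
  addLowDegree v∈W low large = addIndependent v∈W large (≤-trans (≤-reflexive (card-rest v∈W))
    (s≤s (+-mono-≤ low (proj₂ (proj₂ (proj₂ large))))))

  emptyIndependent : ∀ {W} → (∀ v → v ∉ W) → LargeIndependent W
  emptyIndependent {W} empty = W , (λ p → p) , (λ u∈W → ⊥-elim (empty _ u∈W)) ,
    ≤-trans (≤-reflexive (card-empty empty)) z≤n

  -- Choosing a vertex outside `K` uses up at most `k` vertices, itself and its neighbours. Once
  -- only vertices of `K` remain, there are at most `k` of them and one suffices.
  independent-odd : ∀ K → card K ≡ k → (∀ W {v} → v ∉ K → deg H W v ≤ κ) →
    ∀ N W → card W < N → LargeIndependent W
  independent-odd K |K| low (suc N) W bound with find (λ v → v ∈? (W ∖ K))
  ... | inj₁ (v , v∈) = addLowDegree (∖-∈ˡ v∈) (low W (∖-∉ v∈))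
    (independent-odd K |K| low N _ (≤-trans (≤-trans (s≤s (m≤n+m _ _))
      (≤-reflexive (sym (card-rest (∖-∈ˡ v∈))))) (s≤s⁻¹ bound)))
  ... | inj₂ inside with find (_∈? W)
  ...   | inj₂ empty = emptyIndependent empty
  ...   | inj₁ (v , v∈W) = ｛ v ｝ , ｛｝-⊆ v∈W ,
    (λ { p q u~w → nbr-irrefl H (subst₂ (λ x y → x ∈ nbr H y) (｛｝-∈ p) (｛｝-∈ q) u~w) }) ,
    (begin
      card W               ≤⟨ card-⊆ W⊆K ⟩
      card K               ≡⟨ trans |K| (sym (*-identityʳ (k))) ⟩
      k * 1            ≡⟨ cong (k *_) (card-｛｝ v) ⟨
      k * card ｛ v ｝   ∎)
    where
    open ≤-Reasoning
    W⊆K : W ⊆ K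
    W⊆K {u} u∈W with u ∈? K
    ... | yes p = p
    ... | no p  = ⊥-elim (inside u (∖-∈ u∈W p))

  -- If every vertex of W has degree k, the missing matching is perfect on W, so |W| is even.
  -- The k + 1 vertices removed then leave an odd number, which is not a multiple of k.
  independent-even : ∀ h (M : GraphOn m) → k ≡ 2 * h → (∀ W v → deg M W v ≤ 1) →
    (∀ W v → deg H W v ≤ κ + deg M W v) → ∀ N W → card W < N → LargeIndependent W
  independent-even h M even matching low (suc N) W bound with find (λ v → (v ∈? W) ×-dec (deg H W v ≤? κ))
  ... | inj₁ (v , v∈W , small) = addLowDegree v∈W small
    (independent-even h M even matching low N _ (≤-trans (≤-trans (s≤s (m≤n+m _ _))
      (≤-reflexive (sym (card-rest v∈W)))) (s≤s⁻¹ bound)))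
  ... | inj₂ large with find (_∈? W)
  ...   | inj₂ empty = emptyIndependent empty
  ...   | inj₁ (v , v∈W)
    with independent-even h M even matching low N (rest W v) (≤-trans (≤-trans (s≤s (m≤n+m _ _))
      (≤-reflexive (sym (card-rest v∈W)))) (s≤s⁻¹ bound))
  ...     | I , I⊆ , indep , |I| = addIndependent v∈W (I , I⊆ , indep , |I|) (begin
      card W                                 ≡⟨ card-rest v∈W ⟩
      suc (deg H W v + card (rest W v))      ≡⟨ cong (λ d → suc (d + card (rest W v))) (regular v∈W) ⟩
      suc (k + card (rest W v))          ≡⟨ +-suc (k) _ ⟨
      k + suc (card (rest W v))          ≤⟨ +-monoʳ-≤ (k) (≤∧≢⇒< |I| odd) ⟩
      k + k * card I                 ∎)
    where
    open ≤-Reasoning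
    bothDegrees : ∀ {u} → u ∈ W → k ≤ deg H W u
    bothDegrees u∈W = ≰⇒> λ le → large _ (u∈W , le)
    perfect : ∀ {u} → u ∈ W → deg M W u ≡ 1
    perfect {u} u∈W = ≤-antisym (matching W u)
      (+-cancelˡ-≤ κ _ _ (≤-trans (≤-reflexive (+-comm κ 1)) (≤-trans (bothDegrees u∈W) (low W u))))
    regular : ∀ {u} → u ∈ W → deg H W u ≡ k
    regular {u} u∈W = ≤-antisym (≤-trans (low W u) (≤-reflexive (trans (cong (κ +_) (perfect u∈W)) (+-comm κ 1))))
      (bothDegrees u∈W)
    odd : ¬ card (rest W v) ≡ k * card I
    odd eq with vol-even M _ W refl
    ... | e , evenVol = even≢odd e (h + h * card I) (trans (sym evenVol)
      (trans (∑-cong perfect) (trans (card-∑ W) (trans (card-rest v∈W) (trans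
        (cong (λ d → suc (d + card (rest W v))) (regular v∈W))
        (cong suc (trans (cong₂ _+_ even (trans eq (trans (cong (_* card I) even) (*-assoc 2 h (card I)))))
          (sym (*-distribˡ-+ 2 h (h * card I))))))))))

-- Colourings of a complete graph with the edges of `M` missing

module Colours {m : ℕ} (M : GraphOn m) (col : Colouring (toGraph (complement M))) where

  private
    c     = proj₁ col
    c-sym = proj₂ col

  coloured : Bool → GraphOn m
  coloured b = record
    { nbr        = λ v → nbr (complement M) v ∩ ⟪ (λ u → c v u Bool.≟ b) ⟫
    ; nbr-sym    = λ {u} {v} p → ∩-∈ (nbr-sym (complement M) (∩-∈ˡ p)) (∈-⟪⟫ (trans (c-sym u v) (⟪⟫-∈ (∩-∈ʳ p))))
    ; nbr-irrefl = λ p → nbr-irrefl (complement M) (∩-∈ˡ p)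
    }

  -- Its edges are the red edges and the missing pairs, so an independent set is a blue clique.
  nonBlue : GraphOn m
  nonBlue = complement (coloured false)

  nonBlue-∈ : ∀ {u v} → u ∈ nbr nonBlue v → u ∈ nbr (coloured true) v ⊎ u ∈ nbr M v
  nonBlue-∈ {u} {v} p with u ∈? nbr M v
  ... | yes q = inj₂ q
  ... | no q with complement-∈ M (λ u≡v → ∖-∉ (∖-∈ˡ p) (subst (_∈ ｛ v ｝) (sym u≡v) self-∈)) q | c v u in eq
  ...   | edge | true  = inj₁ (∩-∈ edge (∈-⟪⟫ eq))
  ...   | edge | false = ⊥-elim (∖-∉ p (∩-∈ edge (∈-⟪⟫ eq)))

  deg-nonBlue : ∀ W v → deg nonBlue W v ≤ deg (coloured true) W v + deg M W v
  deg-nonBlue W v = begin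
    deg nonBlue W v
      ≡⟨ card-split (∩-∖-split (W ∩ nbr nonBlue v) (nbr M v)) ⟩
    card ((W ∩ nbr nonBlue v) ∩ nbr M v) + card ((W ∩ nbr nonBlue v) ∖ nbr M v)
      ≤⟨ +-mono-≤ (card-⊆ λ p → ∩-∈ (∩-∈ˡ (∩-∈ˡ p)) (∩-∈ʳ p))
                  (card-⊆ λ p → ∩-∈ (∩-∈ˡ (∖-∈ˡ p)) (pick (nonBlue-∈ (∩-∈ʳ (∖-∈ˡ p))) (∖-∉ p))) ⟩
    deg M W v + deg (coloured true) W v
      ≡⟨ +-comm (deg M W v) _ ⟩
    deg (coloured true) W v + deg M W v ∎
    where
    open ≤-Reasoning
    pick : ∀ {u} → u ∈ nbr (coloured true) v ⊎ u ∈ nbr M v → u ∉ nbr M v → u ∈ nbr (coloured true) v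
    pick (inj₁ p) _ = p
    pick (inj₂ p) q = ⊥-elim (q p)

  redStar : ∀ {v k} → k ≤ card (nbr (coloured true) v) → MonoCopy (toGraph (complement M)) col true (star k)
  redStar {v} {k} le with enumerate k le
  ... | φ , inj , into = φ′ , inj′ , copy
    where
    φ′ : Fin (suc k) → Fin m
    φ′ zero    = v
    φ′ (suc i) = φ i
    φi≢v : ∀ i → ¬ φ i ≡ v
    φi≢v i e = nbr-irrefl (coloured true) (subst (_∈ nbr (coloured true) v) e (into i))
    inj′ : Injective _≡_ _≡_ φ′
    inj′ {zero}  {zero}  e = refl
    inj′ {zero}  {suc j} e = ⊥-elim (φi≢v j (sym e))
    inj′ {suc i} {zero}  e = ⊥-elim (φi≢v i e)
    inj′ {suc i} {suc j} e = cong suc (inj e)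
    copy : ∀ i j → adj (star k) i j ≡ true →
      (nbr (complement M) (φ′ i) (φ′ j) ≡ true) × (c (φ′ i) (φ′ j) ≡ true)
    copy zero    (suc j) _ = holds (∩-∈ˡ (into j)) , ⟪⟫-∈ (∩-∈ʳ (into j))
    copy (suc i) zero    _ = let p = nbr-sym (coloured true) (into i) in holds (∩-∈ˡ p) , ⟪⟫-∈ (∩-∈ʳ p)

  blueClique : ∀ {n I} → n ≤ card I → Independent nonBlue I →
    MonoCopy (toGraph (complement M)) col false (complete n)
  blueClique {n} {I} le indep with enumerate n le
  ... | φ , inj , into = φ , inj , copy
    where
    copy : ∀ i j → adj (complete n) i j ≡ true →
      (nbr (complement M) (φ i) (φ j) ≡ true) × (c (φ i) (φ j) ≡ false)
    copy i j p with φ j ∈? nbr (coloured false) (φ i)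
    ... | yes q = holds (∩-∈ˡ q) , ⟪⟫-∈ (∩-∈ʳ q)
    ... | no q  = ⊥-elim (indep (into j) (into i)
      (complement-∈ (coloured false) (λ e → complete-adj⁻¹ p (inj (sym e))) q))

-- Without a red star all red degrees are at most `κ`. An independent set `I` with R k + 1 ≤ k |I|,
-- where k = `suc κ`, then has more than `R` vertices.
arrows-by-independence : ∀ R κ (M : GraphOn (suc (R * suc κ))) →
  (∀ col → let open Colours M col in (∀ W v → deg (coloured true) W v ≤ κ) →
     LargeIndependent nonBlue κ everything) →
  Arrows (toGraph (complement M)) (star (suc κ)) (complete (suc R))
arrows-by-independence R κ M large col with find (λ v → suc κ ≤? card (nbr (Colours.coloured M col true) v))
... | inj₁ (v , many) = inj₁ (Colours.redStar M col many)
... | inj₂ few with large col (λ W v → ≤-trans (card-⊆ ∩-∈ʳ) (s≤s⁻¹ (≰⇒> (few v))))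
... | I , _ , indep , |I| = inj₂ (Colours.blueClique M col
  (*-cancelʳ-< (suc κ) R (card I) (≤-trans (≤-reflexive (sym (card-everything (suc (R * suc κ)))))
    (≤-trans |I| (≤-reflexive (*-comm (suc κ) (card I)))))) indep)

-- The two extremal graphs

cliqueOn : ∀ {m} → VSet m → GraphOn m
cliqueOn K = record
  -- The second factor ignores the candidate neighbour; it makes vertices outside `K` isolated.
  { nbr        = λ v → (K ∖ ｛ v ｝) ∩ ⟪ (λ _ → v ∈? K) ⟫
  ; nbr-sym    = λ {u} {v} p → ∩-∈ (∖-∈ (⟪⟫-∈ (∩-∈ʳ p)) λ v∈u →
                   ∖-∉ (∩-∈ˡ p) (subst (_∈ ｛ v ｝) (｛｝-∈ v∈u) self-∈)) (∈-⟪⟫ (∖-∈ˡ (∩-∈ˡ p)))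
  ; nbr-irrefl = λ p → ∖-∉ (∩-∈ˡ p) self-∈
  }

vol-cliqueOn : ∀ {m} κ (K : VSet m) → card K ≡ suc κ → suc κ * κ ≤ vol (cliqueOn K) everything
vol-cliqueOn κ K |K| = begin
  suc κ * κ                     ≡⟨ trans (∑-const K κ) (cong (_* κ) |K|) ⟨
  ∑⟨ K ⟩ (λ _ → κ)              ≤⟨ ∑-mono (λ v∈K → ≤-trans
                                     (≤-reflexive (suc-injective (trans (sym |K|) (card-remove v∈K))))
                                     (card-⊆ λ p → ∩-∈ (∖-∈ˡ p) (∩-∈ p (∈-⟪⟫ v∈K)))) ⟩
  vol (cliqueOn K) K            ≤⟨ vol-⊆ (cliqueOn K) (λ _ → everything-∈) ⟩
  vol (cliqueOn K) everything   ∎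
  where open ≤-Reasoning

deg-cliqueOn-∉ : ∀ {m} {K : VSet m} W {v} → v ∉ K → deg (cliqueOn K) W v ≡ 0
deg-cliqueOn-∉ W v∉K = card-empty λ u p → v∉K (⟪⟫-∈ (∩-∈ʳ (∩-∈ʳ p)))

-- Exchanges 2i and 2i + 1.
partner : ℕ → ℕ
partner 0             = 1
partner 1             = 0
partner (suc (suc n)) = suc (suc (partner n))

partner-involutive : ∀ n → partner (partner n) ≡ n
partner-involutive 0             = refl
partner-involutive 1             = refl
partner-involutive (suc (suc n)) = cong (λ i → suc (suc i)) (partner-involutive n)

partner-≢ : ∀ n → ¬ partner n ≡ n
partner-≢ (suc (suc n)) e = partner-≢ n (suc-injective (suc-injective e))

partner-< : ∀ e n → n < e * 2 → partner n < e * 2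
partner-< (suc e) 0             lt = s≤s (s≤s z≤n)
partner-< (suc e) 1             lt = s≤s z≤n
partner-< (suc e) (suc (suc n)) lt = s≤s (s≤s (partner-< e n (s≤s⁻¹ (s≤s⁻¹ lt))))

-- For odd `m` the partner of the last vertex is out of range, so that vertex stays unmatched and
-- the matching is maximum.
pairing : ∀ m → GraphOn m
pairing m = record
  { nbr        = λ v → ⟪ (λ u → toℕ u ≟ℕ partner (toℕ v)) ⟫
  ; nbr-sym    = λ {u} {v} p → ∈-⟪⟫ (trans (sym (partner-involutive (toℕ v))) (cong partner (sym (⟪⟫-∈ p))))
  ; nbr-irrefl = λ {v} p → partner-≢ (toℕ v) (sym (⟪⟫-∈ p))
  }

deg-pairing : ∀ {m} W v → deg (pairing m) W v ≤ 1
deg-pairing {m} W v = ≮⇒≥ λ big →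
  let a , a∈ = card>0⇒∃ (<⇒≤ big)
      b , b∈ = card>0⇒∃ (s≤s⁻¹ (≤-trans big (≤-reflexive (card-remove a∈))))
  in ∖-∉ b∈ (subst (_∈ ｛ a ｝) (toℕ-injective (trans (⟪⟫-∈ (∩-∈ʳ a∈)) (sym (⟪⟫-∈ (∩-∈ʳ (∖-∈ˡ b∈)))))) self-∈)

vol-pairing : ∀ a e → a ≡ e * 2 → a ≤ vol (pairing (suc a)) everything
vol-pairing a e a≡2e = begin
  a
    ≡⟨ suc-injective (trans (sym (card-everything (suc a))) (card-remove everything-∈)) ⟩
  card (everything ∖ ｛ fromℕ a ｝) ≡⟨ card-∑ (everything ∖ ｛ fromℕ a ｝) ⟨
  ∑⟨ everything ∖ ｛ fromℕ a ｝ ⟩ (λ _ → 1)                       ≤⟨ ∑-mono paired ⟩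
  ∑⟨ everything ∖ ｛ fromℕ a ｝ ⟩ (deg (pairing (suc a)) everything) ≤⟨ m≤n+m _ _ ⟩
  ∑⟨ ｛ fromℕ a ｝ ⟩ (deg (pairing (suc a)) everything) +
    ∑⟨ everything ∖ ｛ fromℕ a ｝ ⟩ (deg (pairing (suc a)) everything)
    ≡⟨ ∑-split (deg (pairing (suc a)) everything) (remove-split everything-∈) ⟨
  vol (pairing (suc a)) everything ∎
  where
  open ≤-Reasoning
  paired : ∀ {v} → v ∈ everything ∖ ｛ fromℕ a ｝ → 1 ≤ deg (pairing (suc a)) everything v
  paired {v} v∈ = ∈⇒deg>0 (pairing (suc a)) {u = fromℕ< p<} everything-∈ (∈-⟪⟫ (toℕ-fromℕ< p<))
    where
    v<a : toℕ v < a
    v<a = ≤∧≢⇒< (toℕ≤pred[n] v) λ e → ∖-∉ v∈ (subst (_∈ ｛ fromℕ a ｝)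
      (toℕ-injective (trans (toℕ-fromℕ a) (sym e))) self-∈)
    p< : partner (toℕ v) < suc a
    p< = m<n⇒m<1+n (subst (partner (toℕ v) <_) (sym a≡2e) (partner-< e (toℕ v) (subst (toℕ v <_) a≡2e v<a)))

clique-arrows : ∀ R κ (K : VSet (suc (R * suc κ))) → card K ≡ suc κ →
  Arrows (toGraph (complement (cliqueOn K))) (star (suc κ)) (complete (suc R))
clique-arrows R κ K |K| = arrows-by-independence R κ (cliqueOn K) λ col red →
  independent-odd (Colours.nonBlue (cliqueOn K) col) κ K |K|
    (λ W {v} v∉K → ≤-trans (Colours.deg-nonBlue (cliqueOn K) col W v) (≤-trans
      (+-mono-≤ (red W v) (≤-reflexive (deg-cliqueOn-∉ W v∉K))) (≤-reflexive (+-identityʳ κ))))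
    _ everything ≤-refl

pairing-arrows : ∀ R κ h → suc κ ≡ 2 * h →
  Arrows (toGraph (complement (pairing (suc (R * suc κ))))) (star (suc κ)) (complete (suc R))
pairing-arrows R κ h even = arrows-by-independence R κ (pairing _) λ col red →
  independent-even (Colours.nonBlue (pairing _) col) κ h (pairing _) even deg-pairing
    (λ W v → ≤-trans (Colours.deg-nonBlue (pairing _) col W v) (+-monoˡ-≤ _ (red W v)))
    _ everything ≤-refl

-- The Ramsey number, and both bounds combined

spanning : ∀ {m} (G : GraphOn m) {u v} → nbr G u v ≡ true → adj (complete m) u v ≡ true
spanning G p = complete-adj λ { refl → nbr-irrefl G (mem p) }

arrows-complete : ∀ {m} (G : GraphOn m) {A B} → Arrows (toGraph G) A B → Arrows (complete m) A B
arrows-complete {m} G arrows col with arrows col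
... | inj₁ (φ , inj , copy) = inj₁ (φ , inj , λ i j e → let edge , colour = copy i j e in spanning G edge , colour)
... | inj₂ (φ , inj , copy) = inj₂ (φ , inj , λ i j e → let edge , colour = copy i j e in spanning G edge , colour)

-- At most R k vertices can be cut into `R` classes of at most `k`, so a smaller complete graph
-- wins.
complete-lower : ∀ k R N → Arrows (complete N) (star k) (complete (suc R)) → suc (R * k) ≤ N
complete-lower k R N arrows = ≰⇒> λ N≤ → arrows⇒¬wins (complete N) k R arrows
  (subst (Wins (fromGraph (complete N)) k everything) (+-identityʳ R)
    (wins-blocks (fromGraph (complete N)) k R everything (≤-trans (≤-reflexive (card-everything N)) N≤)
      ((λ _ → 0) , λ v∈ → ⊥-elim (∖-∉ v∈ everything-∈))))

-- `t` is twice the number of missing edges. The extremal graph has exactly as many vertices as the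
-- Ramsey number, so it attains both minima, and one lower bound serves for both.
extremal : ∀ R κ t value → let k = suc κ in k * k * k + 2 * (k * k) ≤ R → 2 * value + t ≡ E k R →
  (∀ {m} (G : GraphOn m) → Selection G κ R t) →
  (M : GraphOn (suc (R * k))) → t ≤ vol M everything →
  Arrows (toGraph (complement M)) (star k) (complete (suc R)) →
  IsSizeRamseyNumber (star k) (complete (suc R)) value ×
  IsRestrictedSizeRamseyNumber (star k) (complete (suc R)) value
extremal R κ t value large valueEq select M missing arrows =
  ((F₀ , arrows , edges-F₀) , λ { _ (F , arr , refl) → lower F arr }) ,
  suc (R * k) , (arrows-complete (complement M) {star k} {complete (suc R)} arrows , complete-lower k R) ,
  (F₀ , arrows , refl , edges-F₀) , λ { _ (F , arr , _ , refl) → lower F arr }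
  where
  k = suc κ
  F₀ = toGraph (complement M)
  lower : ∀ F → Arrows F (star k) (complete (suc R)) → value ≤ edges F
  lower F arr = *-cancelˡ-≤ 2 (+-cancelʳ-≤ t _ _ (begin
    2 * value + t                       ≡⟨ valueEq ⟩
    E k R                               ≤⟨ vol-lower-bound (fromGraph F) κ R t everything large (select (fromGraph F))
                                             (arrows⇒¬wins F k R arr) ⟩
    vol (fromGraph F) everything + t    ≡⟨ cong (_+ t) (handshake F) ⟨
    2 * edges F + t                     ∎))
    where open ≤-Reasoning
  edges-F₀ : edges F₀ ≡ value
  -- A lower estimate of the volume of `M` suffices here: the reverse inequality is the lower bound
  -- applied to `F₀` itself.
  edges-F₀ = ≤-antisym (*-cancelˡ-≤ 2 (+-cancelʳ-≤ t _ _ (begin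
    2 * edges F₀ + t                                    ≤⟨ +-monoʳ-≤ (2 * edges F₀) missing ⟩
    2 * edges F₀ + vol M everything                     ≡⟨ cong (_+ vol M everything) (handshake F₀) ⟩
    vol (fromGraph F₀) everything + vol M everything    ≡⟨⟩
    vol (complement M) everything + vol M everything    ≡⟨ +-comm _ (vol M everything) ⟩
    vol M everything + vol (complement M) everything    ≡⟨ vol-complement M everything (card-everything _) ⟩
    E k R                                               ≡⟨ valueEq ⟨
    2 * value + t                                       ∎))) (lower F₀ arrows)
    where open ≤-Reasoning

-- Binomial values and the two parities

choose2 : ∀ a → 2 * (suc a C 2) ≡ pairs a
choose2 zero    = refl
choose2 (suc a) = begin
  2 * (suc (suc a) C 2)              ≡⟨ cong (2 *_) (nCk+nC[k+1]≡[n+1]C[k+1] (suc a) 1) ⟨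
  2 * (suc a C 1 + suc a C 2)        ≡⟨ *-distribˡ-+ 2 (suc a C 1) (suc a C 2) ⟩
  2 * (suc a C 1) + 2 * (suc a C 2)  ≡⟨ cong₂ _+_ (cong (2 *_) (nC1≡n (suc a))) (choose2 a) ⟩
  2 * suc a + a * suc a              ≡⟨ rearrange a ⟩
  suc a * suc (suc a)                ∎
  where
  open ≡-Reasoning
  rearrange : ∀ a → 2 * suc a + a * suc a ≡ suc a * suc (suc a)
  rearrange = solve-∀

-- The hypothesis `t ≤ E (suc κ) R` keeps the truncated subtraction exact.
valueEq : ∀ κ R x t → 2 * x ≡ t → t ≤ E (suc κ) R →
  2 * ((suc κ * R + 1) C 2 ∸ x) + t ≡ E (suc κ) R
valueEq κ R x t 2x≡t t≤E = begin
  2 * ((suc κ * R + 1) C 2 ∸ x) + t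
    ≡⟨ cong (_+ t) (*-distribˡ-∸ 2 ((suc κ * R + 1) C 2) x) ⟩
  2 * ((suc κ * R + 1) C 2) ∸ 2 * x + t
    ≡⟨ cong₂ (λ y z → y ∸ z + t) (trans (cong (λ N → 2 * (N C 2)) size) (choose2 (R * suc κ))) 2x≡t ⟩
  E (suc κ) R ∸ t + t
    ≡⟨ m∸n+n≡m t≤E ⟩
  E (suc κ) R ∎
  where
  open ≡-Reasoning
  size : suc κ * R + 1 ≡ suc (R * suc κ)
  size = trans (+-comm _ 1) (cong suc (*-comm (suc κ) R))

starCompleteValue-odd : ∀ k n → k % 2 ≡ 1 → starCompleteValue k n ≡ (k * (n ∸ 1) + 1) C 2 ∸ k C 2
starCompleteValue-odd k n odd with k % 2
starCompleteValue-odd k n refl | .1 = refl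

starCompleteValue-even : ∀ k n → k % 2 ≡ 0 → starCompleteValue k n ≡ (k * (n ∸ 1) + 1) C 2 ∸ (k * (n ∸ 1)) / 2
starCompleteValue-even k n even with k % 2
starCompleteValue-even k n refl | .0 = refl

parity : ∀ k → k % 2 ≡ 0 ⊎ k % 2 ≡ 1
parity k = [ (λ lt → inj₁ (n<1⇒n≡0 lt)) , inj₂ ]′ (m≤n⇒m<n∨m≡n (s≤s⁻¹ (m%n<n k 2)))

theorem3 : (k n : ℕ) → 2 ≤ k → k ^ 3 + 2 * k ^ 2 + 2 * k ≤ n →
    IsSizeRamseyNumber (star k) (complete n) (starCompleteValue k n) ×
    IsRestrictedSizeRamseyNumber (star k) (complete n) (starCompleteValue k n)
theorem3 (suc κ) zero k≥2 n-large = ⊥-elim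
  (n≮0 (≤-trans (m≤n+m (2 * suc κ) (suc κ ^ 3 + 2 * suc κ ^ 2)) n-large))
theorem3 (suc κ) (suc R) (s≤s κ>0) n-large = [ even , odd ]′ (parity k)
  where
  k = suc κ
  R-large : k * k * k + 2 * (k * k) ≤ R
  R-large = arith κ R n-large
    where
    arith : ∀ κ R → suc κ * (suc κ * (suc κ * 1)) + 2 * (suc κ * (suc κ * 1)) + 2 * suc κ ≤ suc R →
      suc κ * suc κ * suc κ + 2 * (suc κ * suc κ) ≤ R
    arith κ R p = ≤-certificate (1 + 2 * κ) p (solve (κ ∷ R ∷ []))
  κ≤R : κ ≤ R
  κ≤R = ≤-trans (arith κ) R-large
    where
    arith : ∀ κ → κ ≤ suc κ * suc κ * suc κ + 2 * (suc κ * suc κ)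
    arith κ = ≤-certificate (κ * κ * κ + 5 * (κ * κ) + 6 * κ + 3) (z≤n {0}) (solve (κ ∷ []))
  divide : ∀ {r} → k % 2 ≡ r → k ≡ r + 2 * (k / 2)
  divide refl = trans (m≡m%n+[m/n]*n k 2) (cong (k % 2 +_) (*-comm (k / 2) 2))

  odd : k % 2 ≡ 1 → _
  odd k%2≡1 = subst (λ x → IsSizeRamseyNumber (star k) (complete (suc R)) x ×
      IsRestrictedSizeRamseyNumber (star k) (complete (suc R)) x) (sym (starCompleteValue-odd k (suc R) k%2≡1))
    (extremal R κ (k * κ) _ R-large
      (valueEq κ R (k C 2) (k * κ) (trans (choose2 κ) (*-comm κ k))
        (≤-trans (≤-reflexive (*-comm k κ)) (*-mono-≤ (≤-trans κ≤R (m≤m*n R k)) (s≤s (≤-trans κ≤R (m≤m*n R k))))))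
      (λ G s A _ _ noFull → selection-odd (complement G) κ κ>0 A noFull (k / 2) (divide k%2≡1))
      (cliqueOn K) (vol-cliqueOn κ K |K|) (clique-arrows R κ K |K|))
    where
    clique = subsetOfSize {suc (R * k)} everything k (≤-trans (s≤s (≤-trans κ≤R (m≤m*n R k)))
      (≤-reflexive (sym (card-everything (suc (R * k))))))
    K = proj₁ clique
    |K| = proj₂ (proj₂ clique)

  even : k % 2 ≡ 0 → _
  even k%2≡0 = subst (λ x → IsSizeRamseyNumber (star k) (complete (suc R)) x ×
      IsRestrictedSizeRamseyNumber (star k) (complete (suc R)) x) (sym (starCompleteValue-even k (suc R) k%2≡0))
    (extremal R κ (R * k) _ R-large
      (valueEq κ R ((k * R) / 2) (R * k) halved (m≤m*n (R * k) (suc (R * k))))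
      (λ G s A s≤R |A| noFull → selection-even (complement G) κ κ>0 A noFull (k / 2) s R k≡2h |A| s≤R κ≤R)
      (pairing _) (vol-pairing (R * k) (R * (k / 2)) Rk≡) (pairing-arrows R κ (k / 2) k≡2h))
    where
    k≡2h : k ≡ 2 * (k / 2)
    k≡2h = divide k%2≡0
    Rk≡ : R * k ≡ R * (k / 2) * 2
    Rk≡ = trans (cong (R *_) (trans k≡2h (*-comm 2 (k / 2)))) (sym (*-assoc R (k / 2) 2))
    -- The division is exact because `k` is even.
    halved : 2 * ((k * R) / 2) ≡ R * k
    halved = begin
      2 * ((k * R) / 2)               ≡⟨ cong (λ x → 2 * (x / 2)) (trans (*-comm k R) Rk≡) ⟩
      2 * ((R * (k / 2) * 2) / 2)     ≡⟨ cong (2 *_) (m*n/n≡m (R * (k / 2)) 2) ⟩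
      2 * (R * (k / 2))               ≡⟨ *-comm 2 (R * (k / 2)) ⟩
      R * (k / 2) * 2                 ≡⟨ Rk≡ ⟨
      R * k                           ∎
      where open ≡-Reasoning
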